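{- Let row sums $\mathcal{R} = (r_1, r_2, \ldots, r_m)$ and column sums $\mathcal{C} = (c_1, c_2, \ldots, c_n)$ be given, where $r_1 \geq r_2 \geq \cdots \geq r_m$ and $c_1 \geq c_2 \geq \cdots \geq c_n$. Assume that the line sums $(\mathcal{R},\mathcal{C})$ are consistent but do not uniquely determine a set. Let $\alpha = \alpha(\mathcal{R},\mathcal{C})$. Then there exist finite sets $F_2, F_3 \subset \mathbb{Z}^2$, both with line sums $(\mathcal{R},\mathcal{C})$, such that \[ |F_2 \bigtriangleup F_3| \geq 2\alpha + 2 . \] This bound is sharp: for each integer $\alpha \geq 1$ there are non-increasing sequences $\mathcal{R}$ and $\mathcal{C}$ such that the line sums $(\mathcal{R},\mathcal{C})$ are consistent, do not uniquely determine a set, satisfy $\alpha(\mathcal{R},\mathcal{C}) = \alpha$, and are such that for any $F_2$ and $F_3$ with line sums $(\mathcal{R},\mathcal{C})$ we have $|F_2 \bigtriangleup F_3| \leq 2\alpha + 2$.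
   Context: For $i \in \mathbb{Z}$, row $i$ is the set $\{(x,y) \in \mathbb{Z}^2 : x = i\}$; for $j \in \mathbb{Z}$, column $j$ is the set $\{(x,y) \in \mathbb{Z}^2 : y = j\}$. For a finite set $F \subset \mathbb{Z}^2$, the row sum of row $i$ is the number of elements of $F$ in row $i$, and the column sum of column $j$ is the number of elements of $F$ in column $j$. Let $\mathcal{R} = (r_1, \ldots, r_m)$ and $\mathcal{C} = (c_1, \ldots, c_n)$ be finite sequences of non-negative integers. A finite set $F \subset \mathbb{Z}^2$ has line sums $(\mathcal{R},\mathcal{C})$ (equivalently, has row sums $\mathcal{R}$ and column sums $\mathcal{C}$) if row $i$ of $F$ has sum $r_i$ for $1 \leq i \leq m$, column $j$ of $F$ has sum $c_j$ for $1 \leq j \leq n$, and all other row and column sums of $F$ are zero (so $F \subseteq \{1,\ldots,m\} \times \{1,\ldots,n\}$). The line sums $(\mathcal{R},\mathcal{C})$ are consistent if there exists a set $F$ with line sums $(\mathcal{R},\mathcal{C})$. They uniquely determine a set if there is exactly one set $F$ with line sums $(\mathcal{R},\mathcal{C})$; thus "consistent but do not uniquely determine a set" means that at least two different sets with these line sums exist. For non-increasing $\mathcal{R}$ and $\mathcal{C}$, put $v_j = \#\{l : 1 \leq l \leq m,\ r_l \geq j\}$ for $1 \leq j \leq n$, and define \[ \alpha(\mathcal{R},\mathcal{C}) = \frac{1}{2} \sum_{j=1}^{n} |c_j - v_j| , \] which is an integer when $(\mathcal{R},\mathcal{C})$ is consistent. $A \bigtriangleup B$ denotes the symmetric difference of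 the sets $A$ and $B$, and $|A|$ the number of elements of $A$. -}

module Defs where

import Algebra.Properties.CommutativeMonoid.Sum as Sum
open import Data.Fin.Base as Fin using (Fin; toℕ)
open import Data.Integer.Base as ℤ using (ℤ; +_; 1ℤ)
import Data.Integer.Properties as ℤ
open import Data.List.Base using (List; length; filter; allFin; _++_)
import Data.List.Membership.DecPropositional as DecMembership
import Data.List.Membership.Propositional as Membership
open import Data.List.Membership.Propositional.Properties using (∈-filter⁻)
open import Data.List.Relation.Unary.Unique.Propositional using (Unique)
import Data.List.Relation.Unary.Unique.Propositional.Properties as Unique
open import Data.Nat.Base as ℕ using (ℕ; suc; ∣_-_∣)
import Data.Nat.Properties as ℕ
open import Data.Product using (∃; ∃!; _×_; _,_; proj₁; proj₂)
open import Data.Product.Properties using (≡-dec)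
open import Data.Rational.Base as ℚ using (ℚ; ½)
open import Data.Vec.Functional using (Vector)
open import Function.Bundles using (_⇔_)
open import Relation.Binary.Definitions using (Antitonic₁; DecidableEquality)
open import Relation.Binary.PropositionalEquality.Core using (_≡_)
open import Relation.Nullary.Decidable.Core using (Dec; ¬?)
open import Relation.Nullary.Negation.Core using (¬_)

open Sum ℕ.+-0-commutativeMonoid using (sum)

private
  variable
    m n : ℕ

Point : Set
Point = ℤ × ℤ

_≟_ : DecidableEquality Point
_≟_ = ≡-dec ℤ._≟_ ℤ._≟_

open DecMembership _≟_ using (_∈?_)

-- A finite subset of ℤ² is a duplicate-free list of points; the order of the
-- list is immaterial, so sets are compared by _≐_ and not by _≡_.
record FiniteSet : Set where
  constructor mkFiniteSet
  field
    elements : List Point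
    unique   : Unique elements

open FiniteSet public

infix 4 _∈_ _≐_ _∉?_

_∈_ : Point → FiniteSet → Set
p ∈ F = p Membership.∈ elements F

_≐_ : FiniteSet → FiniteSet → Set
F ≐ G = ∀ p → p ∈ F ⇔ p ∈ G

card : FiniteSet → ℕ
card F = length (elements F)

infixl 6 _∖_ _△_

_∉?_ : ∀ p F → Dec (¬ p ∈ F)
p ∉? F = ¬? (p ∈? elements F)

_∖_ : FiniteSet → FiniteSet → FiniteSet
F ∖ G = mkFiniteSet
  (filter (_∉? G) (elements F))
  (Unique.filter⁺ (_∉? G) (unique F))

_△_ : FiniteSet → FiniteSet → FiniteSet
F △ G = mkFiniteSet
  (elements (F ∖ G) ++ elements (G ∖ F))
  (Unique.++⁺ (unique (F ∖ G)) (unique (G ∖ F))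
    λ (p∈F∖G , p∈G∖F) →
      proj₂ (∈-filter⁻ (_∉? F) {xs = elements G} p∈G∖F)
            (proj₁ (∈-filter⁻ (_∉? G) p∈F∖G)))

rowSum : FiniteSet → ℤ → ℕ
rowSum F i = length (filter (λ p → proj₁ p ℤ.≟ i) (elements F))

columnSum : FiniteSet → ℤ → ℕ
columnSum F j = length (filter (λ p → proj₂ p ℤ.≟ j) (elements F))

-- Fin is indexed from 0, whereas rows, columns and line sums are numbered
-- from 1.
number : Fin n → ℕ
number i = suc (toℕ i)

record HasLineSums (R : Vector ℕ m) (C : Vector ℕ n) (F : FiniteSet) : Set where
  field
    rows         : ∀ i → rowSum F (+ number i) ≡ R i
    columns      : ∀ j → columnSum F (+ number j) ≡ C j
    otherRows    : ∀ i → ¬ (1ℤ ℤ.≤ i × i ℤ.≤ + m) → rowSum F i ≡ 0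
    otherColumns : ∀ j → ¬ (1ℤ ℤ.≤ j × j ℤ.≤ + n) → columnSum F j ≡ 0

NonIncreasing : Vector ℕ n → Set
NonIncreasing = Antitonic₁ Fin._≤_ ℕ._≤_

Consistent : Vector ℕ m → Vector ℕ n → Set
Consistent R C = ∃ (HasLineSums R C)

UniquelyDetermine : Vector ℕ m → Vector ℕ n → Set
UniquelyDetermine R C = ∃! _≐_ (HasLineSums R C)

v : Vector ℕ m → Fin n → ℕ
v {m} R j = length (filter (λ l → number j ℕ.≤? R l) (allFin m))

fromℕ : ℕ → ℚ
fromℕ k = + k ℚ./ 1

-- Rational-valued, since the sum need not be even for inconsistent line sums.
α : Vector ℕ m → Vector ℕ n → ℚ
α R C = ½ ℚ.* fromℕ (sum (λ j → ∣ C j - v R j ∣))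

{-# OPTIONS --safe #-}

-- Let T be the Ferrers diagram of R, whose column sums are v, and let A, B be
-- two solutions.  Per row, as long as no row contains an inversion (a cell j in
-- T and a cell k outside T with A = B = 0 at j and A = B = 1 at k), the part of
-- 2T not covered by A + B is at most the number of cells where A and B differ;
-- summed over columns that part is at least Σ 2 (v ∸ C) = 2α.  So a pair without
-- inversions satisfies |A △ B| ≥ 2α.  Since C is non-increasing, an inversion can
-- be removed by a four-cell interchange in A or in B that increases |A △ B|.  If
-- |A △ B| = 2α > 0, all the estimates are equalities, and then some interchange
-- either increases |A △ B| or preserves it while creating an inversion.  Starting
-- from A = B and iterating, |A △ B| eventually exceeds 2α; both numbers are even.
-- If α = 0, then C = v and T is the only solution.
--
-- For sharpness take R = C = (1, …, 1) of length α + 1: every solution has α + 1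
-- elements.

module Submission where

open import Defs
import Algebra.Properties.CommutativeMonoid.Sum as Sum
open import Data.Bool.Base renaming (T to IsTrue) using (Bool; true; false; not; _∧_; _xor_)
import Data.Bool.Properties as Bool
open import Data.Fin.Base as Fin using (Fin; zero; suc; toℕ; fromℕ<)
open import Data.Fin.Patterns using (0F; 1F)
import Data.Fin.Permutation as Permutation
open import Data.Fin.Permutation.Components using (transpose)
import Data.Fin.Properties as Fin
open import Data.Integer.Base as ℤ using (1ℤ)
import Data.Integer.Properties as ℤ
open import Data.List.Base using (List; []; _∷_; length; filter; tabulate; allFin; map; cartesianProduct)
open import Data.List.Membership.DecPropositional _≟_ using (_∈?_)
import Data.List.Membership.Propositional as Membership
open import Data.List.Membership.Propositional.Properties
  using (∈-filter⁺; ∈-filter⁻; ∈-map∘filter⁺; ∈-map∘filter⁻; ∈-allFin; ∈-cartesianProduct⁺; ∈-++⁺ˡ; ∈-++⁺ʳ; ∈-++⁻)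
open import Data.List.Membership.Propositional.Properties.WithK using (unique∧set⇒bag)
open import Data.List.Properties using (filter-none; filter-some; length-map; length-++; length-filter)
open import Data.List.Relation.Binary.BagAndSetEquality using (∼bag⇒↭)
open import Data.List.Relation.Binary.Permutation.Propositional.Properties using (↭-length)
import Data.List.Relation.Unary.All as All
open import Data.List.Relation.Unary.Any using (here; there)
open import Data.List.Relation.Unary.Unique.Propositional using (Unique; []; _∷_)
import Data.List.Relation.Unary.Unique.Propositional.Properties as Unique
open import Data.Nat.Base
open import Data.Nat.Properties hiding (_≟_)
open import Data.Nat.Solver using (module +-*-Solver)
open import Data.Product.Base using (∃-syntax; _×_; _,_; proj₁; proj₂)
open import Data.Rational.Base as ℚ using (½)
import Data.Rational.Properties as ℚ
open import Data.Rational.Unnormalised.Base as ℚᵘ using (mkℚᵘ; *≡*; *≤*)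
import Data.Rational.Unnormalised.Properties as ℚᵘ
open import Data.Sum.Base using (_⊎_; inj₁; inj₂)
open import Data.Unit.Base using (tt)
open import Data.Vec.Functional using (Vector; removeAt)
open import Function.Base using (_∘_; id)
open import Function.Bundles using (_⇔_; mk⇔; Equivalence)
open import Relation.Binary.PropositionalEquality hiding ([_])
open import Relation.Nullary.Decidable using (dec-true; toWitness; True)
open import Relation.Nullary.Decidable.Core using (Dec; does; yes; no; _×-dec_)
open import Relation.Nullary.Negation.Core using (¬_; contradiction)
open import Relation.Unary using (Pred; Decidable)

open Sum +-0-commutativeMonoid
  using (sum; sum-remove; sum-cong-≗; sum-permute; ∑-comm; ∑-distrib-+)

private
  variable
    m n : ℕ

-- Finite sums of natural numbers.

Matrix : ℕ → ℕ → Set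
Matrix m n = Fin m → Fin n → Bool

[_] : Bool → ℕ
[ false ] = 0
[ true  ] = 1

sum₂ : (Fin m → Fin n → ℕ) → ℕ
sum₂ f = sum (λ i → sum (f i))

sum-mono-≤ : {f g : Vector ℕ n} → (∀ i → f i ≤ g i) → sum f ≤ sum g
sum-mono-≤ {zero}  f≤g = z≤n
sum-mono-≤ {suc n} f≤g = +-mono-≤ (f≤g zero) (sum-mono-≤ (f≤g ∘ suc))

sum-mono-< : {f g : Vector ℕ n} → (∀ i → f i ≤ g i) → ∀ i → f i < g i → sum f < sum g
sum-mono-< f≤g zero    f<g = +-mono-<-≤ f<g (sum-mono-≤ (f≤g ∘ suc))
sum-mono-< f≤g (suc i) f<g = +-mono-≤-< (f≤g zero) (sum-mono-< (f≤g ∘ suc) i f<g)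

-- A single strict term would make the sums strictly ordered. This turns the equality case of a
-- summed estimate into equality term by term.
sum-squeeze : {f g : Vector ℕ n} → (∀ i → f i ≤ g i) → sum g ≤ sum f → ∀ i → f i ≡ g i
sum-squeeze f≤g Σg≤Σf i with m≤n⇒m<n∨m≡n (f≤g i)
... | inj₁ f<g = contradiction Σg≤Σf (<⇒≱ (sum-mono-< f≤g i f<g))
... | inj₂ f≡g = f≡g

-- A loss at one index has to be made up at another. Applied to two columns, it finds the second row
-- of an interchange.
sum-pigeonhole : {f g : Vector ℕ n} → sum g ≤ sum f → ∀ i → f i < g i → ∃[ k ] g k < f k
sum-pigeonhole {f = f} {g} Σg≤Σf i f<g with Fin.any? (λ k → g k <? f k)
... | yes found = found
... | no  none  = contradiction Σg≤Σf
  (<⇒≱ (sum-mono-< (λ k → ≮⇒≥ (λ g<f → none (k , g<f))) i f<g))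

sum-zero : ∀ n → sum {n} (λ _ → 0) ≡ 0
sum-zero zero    = refl
sum-zero (suc n) = sum-zero n

sum-positive : {f : Vector ℕ n} → 0 < sum f → ∃[ i ] 0 < f i
sum-positive {n} {f} 0<Σf with Fin.any? (λ i → 0 <? f i)
... | yes found = found
... | no  none  = contradiction 0<Σf (≤⇒≯ (begin
  sum f            ≤⟨ sum-mono-≤ (λ i → ≮⇒≥ (λ 0<f → none (i , 0<f))) ⟩
  sum {n} (λ _ → 0) ≡⟨ sum-zero n ⟩
  0                ∎))
  where open ≤-Reasoning

sum-one : ∀ n → sum {n} (λ _ → 1) ≡ n
sum-one zero    = refl
sum-one (suc n) = cong suc (sum-one n)

positive-sum : {f : Vector ℕ n} → ∀ i → 0 < f i → 0 < sum f
positive-sum {n} {f} i 0<f = subst (_< sum f) (sum-zero n) (sum-mono-< {g = f} (λ _ → z≤n) i 0<f)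

-- The old and the new entry are added on opposite sides, so that no truncated subtraction is
-- involved.
sum-update : ∀ (f g : Vector ℕ n) i → (∀ k → k ≢ i → f k ≡ g k) →
  sum f + g i ≡ sum g + f i
sum-update {suc n} f g i f≡g = begin
  sum f + g i                      ≡⟨ cong (_+ g i) (sum-remove f) ⟩
  f i + sum (removeAt f i) + g i   ≡⟨ cong (λ s → f i + s + g i) (sum-cong-≗ (λ k → f≡g _ (Fin.punchInᵢ≢i i k))) ⟩
  f i + sum (removeAt g i) + g i   ≡⟨ solve 3 (λ a b c → a :+ b :+ c := c :+ b :+ a) refl (f i) _ (g i) ⟩
  g i + sum (removeAt g i) + f i   ≡⟨ cong (_+ f i) (sum-remove g) ⟨
  sum g + f i                      ∎
  where
  open ≡-Reasoning
  open +-*-Solver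

sum-update₂ : ∀ (f g : Vector ℕ n) {i j} → i ≢ j →
  (∀ k → k ≢ i → k ≢ j → f k ≡ g k) →
  sum f + (g i + g j) ≡ sum g + (f i + f j)
sum-update₂ {n} f g {i} {j} i≢j f≡g = begin
  sum f + (g i + g j)  ≡⟨ +-assoc (sum f) _ _ ⟨
  sum f + g i + g j    ≡⟨ cong (λ x → sum f + x + g j) h-i ⟨
  sum f + h i + g j    ≡⟨ cong (_+ g j) (sum-update f h i (λ k k≢i → sym (h-off k k≢i))) ⟩
  sum h + f i + g j    ≡⟨ solve 3 (λ a b c → a :+ b :+ c := a :+ c :+ b) refl (sum h) (f i) (g j) ⟩
  sum h + g j + f i    ≡⟨ cong (_+ f i) (sum-update h g j h-g) ⟩
  sum g + h j + f i    ≡⟨ cong (λ x → sum g + x + f i) (h-off j (i≢j ∘ sym)) ⟩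
  sum g + f j + f i    ≡⟨ solve 3 (λ a b c → a :+ b :+ c := a :+ (c :+ b)) refl (sum g) (f j) (f i) ⟩
  sum g + (f i + f j)  ∎
  where
  open ≡-Reasoning
  open +-*-Solver
  -- An intermediate vector: only entry `i` changes from `f` to `h`, and only entry `j` from `h` to
  -- `g`.
  h : Vector ℕ n
  h k with k Fin.≟ i
  ... | yes _ = g k
  ... | no  _ = f k
  h-i : h i ≡ g i
  h-i with i Fin.≟ i
  ... | yes _   = refl
  ... | no  i≢i = contradiction refl i≢i
  h-off : ∀ k → k ≢ i → h k ≡ f k
  h-off k k≢i with k Fin.≟ i
  ... | yes k≡i = contradiction k≡i k≢i
  ... | no  _   = refl
  h-g : ∀ k → k ≢ j → h k ≡ g k
  h-g k k≢j with k Fin.≟ i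
  ... | yes _   = refl
  ... | no  k≢i = f≡g k k≢i k≢j

-- `sum-update₂` is applied twice: to the vector of row sums, where two rows change, and inside each
-- of these rows, where two entries change. The full row sums `Gi` and `Gi′` are carried along and
-- cancelled at the end.
sum₂-update : ∀ (f g : Fin m → Fin n → ℕ) {i i′ j k} → i ≢ i′ → j ≢ k →
  (∀ a b → a ≢ i → a ≢ i′ → f a b ≡ g a b) →
  (∀ a b → b ≢ j → b ≢ k → f a b ≡ g a b) →
  sum₂ f + (g i j + g i k + (g i′ j + g i′ k)) ≡ sum₂ g + (f i j + f i k + (f i′ j + f i′ k))
sum₂-update f g {i} {i′} {j} {k} i≢i′ j≢k rows columns = +-cancelʳ-≡ (Gi + Gi′) _ _ (begin
  sum₂ f + (p + p′) + (Gi + Gi′)   ≡⟨ solve 4 (λ a b c d → a :+ (b :+ c) :+ d := a :+ d :+ (b :+ c)) refl (sum₂ f) p p′ (Gi + Gi′) ⟩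
  sum₂ f + (Gi + Gi′) + (p + p′)   ≡⟨ cong (_+ (p + p′)) (sum-update₂ _ _ i≢i′ (λ a a≢i a≢i′ → sum-cong-≗ (λ b → rows a b a≢i a≢i′))) ⟩
  sum₂ g + (Fi + Fi′) + (p + p′)   ≡⟨ solve 5 (λ a b c d e → a :+ (b :+ c) :+ (d :+ e) := a :+ ((b :+ d) :+ (c :+ e))) refl (sum₂ g) Fi Fi′ p p′ ⟩
  sum₂ g + ((Fi + p) + (Fi′ + p′)) ≡⟨ cong₂ (λ x y → sum₂ g + (x + y)) (row i) (row i′) ⟩
  sum₂ g + ((Gi + q) + (Gi′ + q′)) ≡⟨ solve 5 (λ a b c d e → a :+ ((b :+ d) :+ (c :+ e)) := a :+ (d :+ e) :+ (b :+ c)) refl (sum₂ g) Gi Gi′ q q′ ⟩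
  sum₂ g + (q + q′) + (Gi + Gi′)   ∎)
  where
  open ≡-Reasoning
  open +-*-Solver
  p  = g i j + g i k
  p′ = g i′ j + g i′ k
  q  = f i j + f i k
  q′ = f i′ j + f i′ k
  Fi  = sum (f i)
  Fi′ = sum (f i′)
  Gi  = sum (g i)
  Gi′ = sum (g i′)
  row : ∀ a → sum (f a) + (g a j + g a k) ≡ sum (g a) + (f a j + f a k)
  row a = sum-update₂ (f a) (g a) j≢k (columns a)

-- Matrices with prescribed line sums and the four-cell interchange.

transpose-left : ∀ (i j : Fin n) → transpose i j i ≡ j
transpose-left i j with i Fin.≟ i
... | yes _   = refl
... | no  i≢i = contradiction refl i≢i

transpose-right : ∀ (i j : Fin n) → transpose i j j ≡ i
transpose-right i j with j Fin.≟ i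
... | yes j≡i = j≡i
... | no  _ with j Fin.≟ j
...   | yes _   = refl
...   | no  j≢j = contradiction refl j≢j

transpose-other : ∀ {i j k : Fin n} → k ≢ i → k ≢ j → transpose i j k ≡ k
transpose-other {i = i} {j} {k} k≢i k≢j with k Fin.≟ i
... | yes k≡i = contradiction k≡i k≢i
... | no  _ with k Fin.≟ j
...   | yes k≡j = contradiction k≡j k≢j
...   | no  _   = refl

record LineSums (R : Vector ℕ m) (C : Vector ℕ n) (A : Matrix m n) : Set where
  constructor lineSums
  field
    rowSums    : ∀ i → sum (λ j → [ A i j ]) ≡ R i
    columnSums : ∀ j → sum (λ i → [ A i j ]) ≡ C j

open LineSums public

-- The Hamming distance; for the sets represented by the two matrices it is the size of the
-- symmetric difference.
distance : Matrix m n → Matrix m n → ℕ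
distance A B = sum₂ (λ i j → [ A i j xor B i j ])

distance-comm : ∀ (A B : Matrix m n) → distance A B ≡ distance B A
distance-comm A B = sum-cong-≗ λ i → sum-cong-≗ λ j → cong [_] (Bool.xor-comm (A i j) (B i j))

-- Encoded as a swap of columns `j` and `k` inside two rows, so that each row is merely permuted. On
-- the alternating pattern assumed in `Interchange` this flips exactly four cells.
interchange : (i i′ : Fin m) (j k : Fin n) → Matrix m n → Matrix m n
interchange i i′ j k A a b with a Fin.≟ i | a Fin.≟ i′
... | yes _ | _     = A a (transpose j k b)
... | no  _ | yes _ = A a (transpose j k b)
... | no  _ | no  _ = A a b

module Interchange (A : Matrix m n) {i i′ : Fin m} {j k : Fin n}
  (A-ij : A i j ≡ false) (A-ik : A i k ≡ true)
  (A-i′j : A i′ j ≡ true) (A-i′k : A i′ k ≡ false) where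

  A′ : Matrix m n
  A′ = interchange i i′ j k A

  i≢i′ : i ≢ i′
  i≢i′ refl with () ← trans (sym A-ij) A-i′j

  j≢k : j ≢ k
  j≢k refl with () ← trans (sym A-ij) A-ik

  first-row : ∀ b → A′ i b ≡ A i (transpose j k b)
  first-row b with i Fin.≟ i | i Fin.≟ i′
  ... | yes _   | _ = refl
  ... | no  i≢i | _ = contradiction refl i≢i

  second-row : ∀ b → A′ i′ b ≡ A i′ (transpose j k b)
  second-row b with i′ Fin.≟ i | i′ Fin.≟ i′
  ... | yes _ | _         = refl
  ... | no  _ | yes _     = refl
  ... | no  _ | no  i′≢i′ = contradiction refl i′≢i′

  other-row : ∀ a b → a ≢ i → a ≢ i′ → A′ a b ≡ A a b
  other-row a b a≢i a≢i′ with a Fin.≟ i | a Fin.≟ i′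
  ... | yes a≡i | _        = contradiction a≡i a≢i
  ... | no  _   | yes a≡i′ = contradiction a≡i′ a≢i′
  ... | no  _   | no  _    = refl

  other-column : ∀ a b → b ≢ j → b ≢ k → A′ a b ≡ A a b
  other-column a b b≢j b≢k with a Fin.≟ i | a Fin.≟ i′
  ... | yes _ | _     = cong (A a) (transpose-other b≢j b≢k)
  ... | no  _ | yes _ = cong (A a) (transpose-other b≢j b≢k)
  ... | no  _ | no  _ = refl

  A′-ij : A′ i j ≡ true
  A′-ij = trans (first-row j) (trans (cong (A i) (transpose-left j k)) A-ik)

  A′-ik : A′ i k ≡ false
  A′-ik = trans (first-row k) (trans (cong (A i) (transpose-right j k)) A-ij)

  A′-i′j : A′ i′ j ≡ false
  A′-i′j = trans (second-row j) (trans (cong (A i′) (transpose-left j k)) A-i′k)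

  A′-i′k : A′ i′ k ≡ true
  A′-i′k = trans (second-row k) (trans (cong (A i′) (transpose-right j k)) A-i′j)

  same-row-sum : ∀ a → sum (λ b → [ A′ a b ]) ≡ sum (λ b → [ A a b ])
  same-row-sum a with a Fin.≟ i | a Fin.≟ i′
  ... | yes _ | _     = sym (sum-permute (λ b → [ A a b ]) (Permutation.transpose j k))
  ... | no  _ | yes _ = sym (sum-permute (λ b → [ A a b ]) (Permutation.transpose j k))
  ... | no  _ | no  _ = refl

  -- Because the four cells alternate, the effect on columns `j` and `k` is also that of swapping
  -- the rows `i` and `i′`, so each of these columns is permuted as well.
  same-column-sum : ∀ b → sum (λ a → [ A′ a b ]) ≡ sum (λ a → [ A a b ])
  same-column-sum b = column (b Fin.≟ j) (b Fin.≟ k)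
    where
    transposed : ∀ b → A′ i b ≡ A i′ b → A′ i′ b ≡ A i b →
      sum (λ a → [ A′ a b ]) ≡ sum (λ a → [ A a b ])
    transposed b at-i at-i′ = begin
      sum (λ a → [ A′ a b ])                  ≡⟨ sum-cong-≗ (λ a → cong [_] (pointwise a (a Fin.≟ i) (a Fin.≟ i′))) ⟩
      sum (λ a → [ A (transpose i i′ a) b ])  ≡⟨ sum-permute (λ a → [ A a b ]) (Permutation.transpose i i′) ⟨
      sum (λ a → [ A a b ])                   ∎
      where
      open ≡-Reasoning
      pointwise : ∀ a → Dec (a ≡ i) → Dec (a ≡ i′) → A′ a b ≡ A (transpose i i′ a) b
      pointwise a (yes refl) _          = trans at-i (cong (λ x → A x b) (sym (transpose-left i i′)))
      pointwise a (no _)     (yes refl) = trans at-i′ (cong (λ x → A x b) (sym (transpose-right i i′)))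
      pointwise a (no a≢i)   (no a≢i′)  =
        trans (other-row a b a≢i a≢i′) (cong (λ x → A x b) (sym (transpose-other a≢i a≢i′)))
    column : Dec (b ≡ j) → Dec (b ≡ k) → sum (λ a → [ A′ a b ]) ≡ sum (λ a → [ A a b ])
    column (yes refl) _          = transposed j (trans A′-ij (sym A-i′j)) (trans A′-i′j (sym A-ij))
    column (no _)     (yes refl) = transposed k (trans A′-ik (sym A-i′k)) (trans A′-i′k (sym A-ik))
    column (no b≢j)   (no b≢k)   = sum-cong-≗ (λ a → cong [_] (other-column a b b≢j b≢k))

  same-line-sums : ∀ {R : Vector ℕ m} {C : Vector ℕ n} → LineSums R C A → LineSums R C A′
  same-line-sums (lineSums rows columns) = lineSums
    (λ a → trans (same-row-sum a) (rows a))
    (λ b → trans (same-column-sum b) (columns b))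

  -- The bracket on the left counts the disagreements of `A` with `B` on the four cells, the bracket
  -- on the right those of `A′`.
  distance-change : ∀ (B : Matrix m n) →
    distance A′ B + ([ B i j ] + [ not (B i k) ] + ([ not (B i′ j) ] + [ B i′ k ])) ≡
    distance A  B + ([ not (B i j) ] + [ B i k ] + ([ B i′ j ] + [ not (B i′ k) ]))
  distance-change B = begin
    distance A′ B + ([ B i j ] + [ not (B i k) ] + ([ not (B i′ j) ] + [ B i′ k ]))
      ≡⟨ cong (distance A′ B +_) (cells A A-ij A-ik A-i′j A-i′k) ⟨
    distance A′ B + (δ A i j + δ A i k + (δ A i′ j + δ A i′ k))
      ≡⟨ sum₂-update (δ A′) (δ A) i≢i′ j≢k
           (λ a b a≢i a≢i′ → cong (λ x → [ x xor B a b ]) (other-row a b a≢i a≢i′))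
           (λ a b b≢j b≢k → cong (λ x → [ x xor B a b ]) (other-column a b b≢j b≢k)) ⟩
    distance A B + (δ A′ i j + δ A′ i k + (δ A′ i′ j + δ A′ i′ k))
      ≡⟨ cong (distance A B +_) (cells′ A′ A′-ij A′-ik A′-i′j A′-i′k) ⟩
    distance A  B + ([ not (B i j) ] + [ B i k ] + ([ B i′ j ] + [ not (B i′ k) ])) ∎
    where
    open ≡-Reasoning
    δ : Matrix m n → Fin m → Fin n → ℕ
    δ X a b = [ X a b xor B a b ]
    cells : ∀ X → X i j ≡ false → X i k ≡ true → X i′ j ≡ true → X i′ k ≡ false →
      δ X i j + δ X i k + (δ X i′ j + δ X i′ k) ≡ [ B i j ] + [ not (B i k) ] + ([ not (B i′ j) ] + [ B i′ k ])
    cells X e₁ e₂ e₃ e₄ rewrite e₁ | e₂ | e₃ | e₄ = refl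
    cells′ : ∀ X → X i j ≡ true → X i k ≡ false → X i′ j ≡ false → X i′ k ≡ true →
      δ X i j + δ X i k + (δ X i′ j + δ X i′ k) ≡ [ not (B i j) ] + [ B i k ] + ([ B i′ j ] + [ not (B i′ k) ])
    cells′ X e₁ e₂ e₃ e₄ rewrite e₁ | e₂ | e₃ | e₄ = refl

-- Booleans and truncated subtraction.

false≢true : ∀ {b} → b ≡ false → b ≡ true → ∀ {ℓ} {X : Set ℓ} → X
false≢true refl ()

separate : ∀ (f : Fin n → Bool) {i j} → f i ≡ false → f j ≡ true → i ≢ j
separate f fi fj refl = false≢true fi fj

-- Both sides are the maximum of `a` and `b`.
∸-+-comm : ∀ a b → a ∸ b + b ≡ b ∸ a + a
∸-+-comm zero    b       = trans (cong (_+ b) (0∸n≡0 b)) (sym (+-identityʳ b))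
∸-+-comm (suc a) zero    = +-identityʳ (suc a)
∸-+-comm (suc a) (suc b) = trans (+-suc _ b) (trans (cong suc (∸-+-comm a b)) (sym (+-suc _ a)))

pos-∸ : ∀ a b → 0 < a ∸ b → b ∸ a ≡ 0
pos-∸ a b pos = m≤n⇒m∸n≡0 (<⇒≤ (m∸n≢0⇒n<m {a} {b} (λ a∸b≡0 → <⇒≢ pos (sym a∸b≡0))))

∣-∣≡∸+∸ : ∀ a b → ∣ a - b ∣ ≡ (a ∸ b) + (b ∸ a)
∣-∣≡∸+∸ zero    b       = cong (_+ b) (sym (0∸n≡0 b))
∣-∣≡∸+∸ (suc a) zero    = sym (+-identityʳ (suc a))
∣-∣≡∸+∸ (suc a) (suc b) = ∣-∣≡∸+∸ a b

-- Indicator sums and the Ferrers diagram.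

length-filter-tabulate : ∀ {a p} {A : Set a} {P : Pred A p} (P? : Decidable P) (f : Fin n → A) →
  length (filter P? (tabulate f)) ≡ sum (λ i → [ does (P? (f i)) ])
length-filter-tabulate {zero}  P? f = refl
length-filter-tabulate {suc n} P? f with does (P? (f zero))
... | true  = cong suc (length-filter-tabulate P? (f ∘ suc))
... | false = length-filter-tabulate P? (f ∘ suc)

ferrers : Vector ℕ m → Matrix m n
ferrers R i j = does (number j ≤? R i)

sum-initial-segment : ∀ n r → r ≤ n → sum {n} (λ j → [ does (number j ≤? r) ]) ≡ r
sum-initial-segment n       zero    _         = sum-zero n
sum-initial-segment (suc n) (suc r) (s≤s r≤n) = cong suc (sum-initial-segment n r r≤n)

ferrers-columns : ∀ (R : Vector ℕ m) (j : Fin n) → sum (λ i → [ ferrers R i j ]) ≡ v R j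
ferrers-columns R j = sym (length-filter-tabulate (λ l → number j ≤? R l) (λ i → i))

-- Each row of the diagram is an initial segment.
ferrers-< : ∀ (R : Vector ℕ m) {i} {j k : Fin n} →
  ferrers R i j ≡ true → ferrers R i k ≡ false → toℕ j < toℕ k
ferrers-< R {i} {j} {k} Tij Tik = s≤s⁻¹ (≤-<-trans j<R (≰⇒> k≮R))
  where
  j<R : number j ≤ R i
  j<R = ≤ᵇ⇒≤ (number j) (R i) (subst IsTrue (sym Tij) tt)
  k≮R : ¬ number k ≤ R i
  k≮R k<R = false≢true Tik (dec-true (number k ≤? R i) k<R)

entry-sum : (A B : Matrix m n) → Fin m → Fin n → ℕ
entry-sum A B i j = [ A i j ] + [ B i j ]

one-sided : (A B : Matrix m n) → Matrix m n
one-sided A B i j = A i j ∧ not (B i j)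

sum₂-+ : ∀ (f g : Fin m → Fin n → ℕ) → sum₂ (λ i j → f i j + g i j) ≡ sum₂ f + sum₂ g
sum₂-+ f g = trans (sum-cong-≗ (λ i → ∑-distrib-+ (f i) (g i))) (∑-distrib-+ (λ i → sum (f i)) (λ i → sum (g i)))

sum₂-cong : ∀ {f g : Fin m → Fin n → ℕ} → (∀ i j → f i j ≡ g i j) → sum₂ f ≡ sum₂ g
sum₂-cong f≡g = sum-cong-≗ λ i → sum-cong-≗ (f≡g i)

-- Exchanges that increase the distance of two solutions.

module Exchange {m n} (R : Vector ℕ m) (C : Vector ℕ n)
  (C-antitone : NonIncreasing C) (R≤n : ∀ i → R i ≤ n) where

  T : Matrix m n
  T = ferrers R

  T-row : ∀ i → sum (λ j → [ T i j ]) ≡ R i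
  T-row i = sum-initial-segment n (R i) (R≤n i)

  -- By `ferrers-<`, column `j` comes before column `k`; this is how the monotonicity of `C` enters
  -- the exchange argument.
  C-mono : ∀ {i} {j k} → T i j ≡ true → T i k ≡ false → C k ≤ C j
  C-mono Tij Tik = C-antitone (<⇒≤ (ferrers-< R Tij Tik))

  Better : (A B : Matrix m n) → Set
  Better A B = ∃[ A′ ] ∃[ B′ ] LineSums R C A′ × LineSums R C B′ × distance A B < distance A′ B′

  better-sym : ∀ {A B} → Better B A → Better A B
  better-sym {A} {B} (A′ , B′ , LA′ , LB′ , lt) =
    A′ , B′ , LA′ , LB′ , subst (_< distance A′ B′) (distance-comm B A) lt

  -- An interchange in `A` pays when it raises the number of disagreements with `B` on the four
  -- cells. Once the entries of `B` are concrete, the implicit comparison is settled by evaluation.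
  gain : ∀ {A B} → LineSums R C A → LineSums R C B → ∀ {i i′ j k b₁ b₂ b₃ b₄} →
    A i j ≡ false → A i k ≡ true → A i′ j ≡ true → A i′ k ≡ false →
    B i j ≡ b₁ → B i k ≡ b₂ → B i′ j ≡ b₃ → B i′ k ≡ b₄ →
    {True ([ b₁ ] + [ not b₂ ] + ([ not b₃ ] + [ b₄ ]) <?
           [ not b₁ ] + [ b₂ ] + ([ b₃ ] + [ not b₄ ]))} →
    Better A B
  gain {A} {B} LA LB a₁ a₂ a₃ a₄ refl refl refl refl {old<new} =
    A′ , B , same-line-sums LA , LB ,
    -- If the distance did not grow, the left side of `distance-change` would be strictly below its
    -- right side.
    ≰⇒> (λ D′≤D → <⇒≢ (+-mono-≤-< D′≤D (toWitness old<new)) (distance-change B))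
    where open Interchange A a₁ a₂ a₃ a₄

  Inversion : (A B : Matrix m n) → Set
  Inversion A B = ∃[ i ] ∃[ j ] ∃[ k ]
    (T i j ≡ true × T i k ≡ false) ×
    (A i j ≡ false × A i k ≡ true) × (B i j ≡ false × B i k ≡ true)

  inversion? : ∀ A B → Dec (Inversion A B)
  inversion? A B = Fin.any? λ i → Fin.any? λ j → Fin.any? λ k →
    ((T i j Bool.≟ true) ×-dec (T i k Bool.≟ false)) ×-dec
    (((A i j Bool.≟ false) ×-dec (A i k Bool.≟ true)) ×-dec
     ((B i j Bool.≟ false) ×-dec (B i k Bool.≟ true)))

  inversion-sym : ∀ {A B} → Inversion A B → Inversion B A
  inversion-sym (i , j , k , t , a , b) = i , j , k , t , b , a

  entry-sum-column : ∀ {A B} → LineSums R C A → LineSums R C B →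
    ∀ j → sum (λ i → entry-sum A B i j) ≡ C j + C j
  entry-sum-column {A} {B} LA LB j =
    trans (∑-distrib-+ (λ i → [ A i j ]) (λ i → [ B i j ])) (cong₂ _+_ (columnSums LA j) (columnSums LB j))

  entry-sum-row : ∀ {A B} → LineSums R C A → LineSums R C B →
    ∀ i → sum (λ j → entry-sum A B i j) ≡ R i + R i
  entry-sum-row {A} {B} LA LB i =
    trans (∑-distrib-+ (λ j → [ A i j ]) (λ j → [ B i j ])) (cong₂ _+_ (rowSums LA i) (rowSums LB i))

  -- In row `i`, `M` is 0 at `j` and 2 at `k`, although column `j` is at least as heavy as column
  -- `k`. So some row `i′` has the larger `M` at `j`, and there `A` or `B` reads (1, 0).
  -- Interchanging in that matrix gains two disagreements in row `i` and loses none in row `i′`: a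
  -- loss would need the other matrix to read (0, 1), and then `M` would be equal at both cells.
  resolve-inversion : ∀ {A B} → LineSums R C A → LineSums R C B → Inversion A B → Better A B
  resolve-inversion {A} {B} LA LB (i , j , k , (Tij , Tik) , (Aij , Aik) , (Bij , Bik)) = result
    where
    M : Fin m → Fin n → ℕ
    M = entry-sum A B
    column-≤ : sum (λ a → M a k) ≤ sum (λ a → M a j)
    column-≤ = begin
      sum (λ a → M a k)  ≡⟨ entry-sum-column LA LB k ⟩
      C k + C k          ≤⟨ +-mono-≤ (C-mono Tij Tik) (C-mono Tij Tik) ⟩
      C j + C j          ≡⟨ entry-sum-column LA LB j ⟨
      sum (λ a → M a j)  ∎
      where open ≤-Reasoning
    M-i : M i j < M i k
    M-i rewrite Aij | Aik | Bij | Bik = s≤s z≤n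
    cases : ∀ i′ a₃ a₄ b₃ b₄ → A i′ j ≡ a₃ → A i′ k ≡ a₄ → B i′ j ≡ b₃ → B i′ k ≡ b₄ →
      [ a₄ ] + [ b₄ ] < [ a₃ ] + [ b₃ ] → Better A B
    cases i′ true false false false e₁ e₂ e₃ e₄ _ = gain LA LB Aij Aik e₁ e₂ Bij Bik e₃ e₄
    cases i′ true false true  false e₁ e₂ e₃ e₄ _ = gain LA LB Aij Aik e₁ e₂ Bij Bik e₃ e₄
    cases i′ true false true  true  e₁ e₂ e₃ e₄ _ = gain LA LB Aij Aik e₁ e₂ Bij Bik e₃ e₄
    cases i′ true false false true  _  _  _  _  (s≤s ())
    cases i′ false false true false e₁ e₂ e₃ e₄ _ = better-sym {A} {B} (gain LB LA Bij Bik e₃ e₄ Aij Aik e₁ e₂)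
    cases i′ true  true  true false e₁ e₂ e₃ e₄ _ = better-sym {A} {B} (gain LB LA Bij Bik e₃ e₄ Aij Aik e₁ e₂)
    cases i′ false true  true false _  _  _  _  (s≤s ())
    cases i′ true  true  true true  _  _  _  _  (s≤s (s≤s ()))
    cases i′ true  true  false false _  _  _  _  (s≤s ())
    cases i′ true  true  false true _  _  _  _  (s≤s ())
    cases i′ false true  true true _  _  _  _  (s≤s ())
    cases i′ false false true true  _  _  _  _  (s≤s ())
    result : Better A B
    result with i′ , lt ← sum-pigeonhole column-≤ i M-i =
      cases i′ _ _ _ _ refl refl refl refl lt

  -- Where `B` is constant on both pairs of cells, two of the four cells disagree before the
  -- interchange and two after it. The move is free, and the inversion that it creates can then be
  -- resolved at a profit.
  interchange-then : ∀ {A B} → LineSums R C A → LineSums R C B → ∀ {i i′ j k} b c →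
    A i j ≡ false → A i k ≡ true → A i′ j ≡ true → A i′ k ≡ false →
    B i j ≡ b → B i k ≡ b → B i′ j ≡ c → B i′ k ≡ c →
    Inversion (interchange i i′ j k A) B → Better A B
  interchange-then {A} {B} LA LB {i} {i′} {j} {k} b c a₁ a₂ a₃ a₄ b₁ b₂ b₃ b₄ inversion
    with A″ , B″ , LA″ , LB″ , lt ← resolve-inversion (Interchange.same-line-sums A a₁ a₂ a₃ a₄ LA) LB inversion =
    A″ , B″ , LA″ , LB″ , subst (_< distance A″ B″) D′≡D lt
    where
    open Interchange A a₁ a₂ a₃ a₄
    weights : ∀ {b₁ b₂ b₃ b₄} b c → b₁ ≡ b → b₂ ≡ b → b₃ ≡ c → b₄ ≡ c →
      [ b₁ ] + [ not b₂ ] + ([ not b₃ ] + [ b₄ ]) ≡ 2 ×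
      ([ not b₁ ] + [ b₂ ] + ([ b₃ ] + [ not b₄ ])) ≡ 2
    weights false false refl refl refl refl = refl , refl
    weights false true  refl refl refl refl = refl , refl
    weights true  false refl refl refl refl = refl , refl
    weights true  true  refl refl refl refl = refl , refl
    D′≡D : distance A′ B ≡ distance A B
    D′≡D with old , new ← weights b c b₁ b₂ b₃ b₄ = +-cancelʳ-≡ 2 _ _
      (trans (cong (distance A′ B +_) (sym old)) (trans (distance-change B) (cong (distance A B +_) new)))

  -- The positive part of `v R j` minus `C j`, doubled to match the comparison with 2T. The total is
  -- 2α, by `discrepancy≡deficit`.
  deficit : Vector ℕ n
  deficit j = (v R j ∸ C j) + (v R j ∸ C j)

  -- Comparison of A + B with the doubled Ferrers diagram.

  module Excess (A B : Matrix m n) (LA : LineSums R C A) (LB : LineSums R C B) where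

    -- M counts a cell of A ∪ B with multiplicity, and is compared with 2T.
    M missing extra diff : Fin m → Fin n → ℕ
    M       = entry-sum A B
    missing i j = ([ T i j ] + [ T i j ]) ∸ M i j
    extra   i j = M i j ∸ ([ T i j ] + [ T i j ])
    diff    i j = [ A i j xor B i j ]

    balance : ∀ i j → missing i j + M i j ≡ extra i j + ([ T i j ] + [ T i j ])
    balance i j = ∸-+-comm ([ T i j ] + [ T i j ]) (M i j)

    missing⇒¬extra : ∀ i j → 0 < missing i j → extra i j ≡ 0
    missing⇒¬extra i j = pos-∸ ([ T i j ] + [ T i j ]) (M i j)

    extra⇒¬missing : ∀ i j → 0 < extra i j → missing i j ≡ 0
    extra⇒¬missing i j = pos-∸ (M i j) ([ T i j ] + [ T i j ])

    -- In row `i` both `M` and 2T have the sum `R i + R i`, so what is lacking and what is in excess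
    -- balance.
    missing≡extra : ∀ i → sum (missing i) ≡ sum (extra i)
    missing≡extra i = +-cancelʳ-≡ (R i + R i) _ _ (begin
      sum (missing i) + (R i + R i)                        ≡⟨ cong (sum (missing i) +_) (entry-sum-row LA LB i) ⟨
      sum (missing i) + sum (M i)                          ≡⟨ ∑-distrib-+ (missing i) (M i) ⟨
      sum (λ j → missing i j + M i j)                      ≡⟨ sum-cong-≗ (balance i) ⟩
      sum (λ j → extra i j + ([ T i j ] + [ T i j ]))      ≡⟨ ∑-distrib-+ (extra i) _ ⟩
      sum (extra i) + sum (λ j → [ T i j ] + [ T i j ])    ≡⟨ cong (sum (extra i) +_) (∑-distrib-+ (λ j → [ T i j ]) _) ⟩
      sum (extra i) + (sum (λ j → [ T i j ]) + sum (λ j → [ T i j ]))  ≡⟨ cong (λ r → sum (extra i) + (r + r)) (T-row i) ⟩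
      sum (extra i) + (R i + R i) ∎)
      where open ≡-Reasoning

    missingIn extraIn : Vector ℕ n
    missingIn j = sum (λ i → missing i j)
    extraIn   j = sum (λ i → extra i j)

    column-balance : ∀ j → missingIn j + (C j + C j) ≡ extraIn j + (v R j + v R j)
    column-balance j = begin
      missingIn j + (C j + C j)                                 ≡⟨ cong (missingIn j +_) (entry-sum-column LA LB j) ⟨
      missingIn j + sum (λ i → M i j)                           ≡⟨ ∑-distrib-+ (λ i → missing i j) _ ⟨
      sum (λ i → missing i j + M i j)                           ≡⟨ sum-cong-≗ (λ i → balance i j) ⟩
      sum (λ i → extra i j + ([ T i j ] + [ T i j ]))           ≡⟨ ∑-distrib-+ (λ i → extra i j) _ ⟩
      extraIn j + sum (λ i → [ T i j ] + [ T i j ])             ≡⟨ cong (extraIn j +_) (∑-distrib-+ (λ i → [ T i j ]) _) ⟩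
      extraIn j + (sum (λ i → [ T i j ]) + sum (λ i → [ T i j ])) ≡⟨ cong (λ r → extraIn j + (r + r)) (ferrers-columns R j) ⟩
      extraIn j + (v R j + v R j) ∎
      where open ≡-Reasoning

    -- The second alternative is an equation and not only a bound, so that equality of `deficit j`
    -- and `missingIn j` can later force `extraIn j` to vanish.
    deficit-cases : ∀ j → deficit j ≡ 0 ⊎ extraIn j + deficit j ≡ missingIn j
    deficit-cases j with ≤-total (v R j) (C j)
    ... | inj₁ v≤C = inj₁ (cong₂ _+_ (m≤n⇒m∸n≡0 v≤C) (m≤n⇒m∸n≡0 v≤C))
    ... | inj₂ C≤v = inj₂ (+-cancelʳ-≡ (C j + C j) _ _ (begin
      extraIn j + (d + d) + (C j + C j)    ≡⟨ solve 3 (λ a b c → a :+ (b :+ b) :+ (c :+ c) := a :+ ((b :+ c) :+ (b :+ c))) refl (extraIn j) d (C j) ⟩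
      extraIn j + ((d + C j) + (d + C j))  ≡⟨ cong (λ x → extraIn j + (x + x)) (m∸n+n≡m C≤v) ⟩
      extraIn j + (v R j + v R j)          ≡⟨ column-balance j ⟨
      missingIn j + (C j + C j)            ∎))
      where
      open ≡-Reasoning
      open +-*-Solver
      d = v R j ∸ C j

    deficit≤missing : ∀ j → deficit j ≤ missingIn j
    deficit≤missing j with deficit-cases j
    ... | inj₁ d≡0 = ≤-trans (≤-reflexive d≡0) z≤n
    ... | inj₂ eq  = ≤-trans (m≤n+m (deficit j) (extraIn j)) (≤-reflexive eq)

    -- If the row has a cell of `T` empty in both matrices, then no cell outside `T` is full in
    -- both, and every extra unit sits on a cell where they differ. If it has no such empty cell,
    -- every missing unit sits on a cell where they differ.
    row-bounded : ¬ Inversion A B → ∀ i →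
      (∀ j → missing i j ≤ diff i j) ⊎ (∀ j → extra i j ≤ diff i j)
    row-bounded none i
      with Fin.any? (λ j → (T i j Bool.≟ true) ×-dec ((A i j Bool.≟ false) ×-dec (B i j Bool.≟ false)))
    ... | yes (j , Tij , Aij , Bij) = inj₂ λ k → bound k (T i k) (A i k) (B i k) refl refl refl
      where
      bound : ∀ k t a b → T i k ≡ t → A i k ≡ a → B i k ≡ b → [ a ] + [ b ] ∸ ([ t ] + [ t ]) ≤ [ a xor b ]
      bound k false true  true  t a b = contradiction (i , j , k , (Tij , t) , (Aij , a) , (Bij , b)) none
      bound k false false false _ _ _ = z≤n
      bound k false false true  _ _ _ = ≤-refl
      bound k false true  false _ _ _ = ≤-refl
      bound k true  false false _ _ _ = z≤n
      bound k true  false true  _ _ _ = z≤n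
      bound k true  true  false _ _ _ = z≤n
      bound k true  true  true  _ _ _ = z≤n
    ... | no full = inj₁ λ j → bound j (T i j) (A i j) (B i j) refl refl refl
      where
      bound : ∀ j t a b → T i j ≡ t → A i j ≡ a → B i j ≡ b → ([ t ] + [ t ]) ∸ ([ a ] + [ b ]) ≤ [ a xor b ]
      bound j true  false false t a b = contradiction (j , t , a , b) full
      bound j false a     b     _ _ _ = ≤-trans (≤-reflexive (0∸n≡0 ([ a ] + [ b ]))) z≤n
      bound j true  false true  _ _ _ = ≤-refl
      bound j true  true  false _ _ _ = ≤-refl
      bound j true  true  true  _ _ _ = z≤n

    -- By `missing≡extra`, both alternatives of `row-bounded` bound the same number.
    missing≤diff : ¬ Inversion A B → ∀ i → sum (missing i) ≤ sum (diff i)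
    missing≤diff none i with row-bounded none i
    ... | inj₁ missing≤ = sum-mono-≤ missing≤
    ... | inj₂ extra≤   = subst (_≤ sum (diff i)) (sym (missing≡extra i)) (sum-mono-≤ extra≤)

    -- The equality case: `tight` closes the chain from `sum deficit` through `sum₂ missing` to
    -- `distance A B`, so equality holds in each column and in each row.
    module Tight (none : ¬ Inversion A B) (tight : distance A B ≤ sum deficit) where

      total : sum missingIn ≡ sum₂ missing
      total = sym (∑-comm missing)

      columns-tight : ∀ j → deficit j ≡ missingIn j
      columns-tight = sum-squeeze deficit≤missing (begin
        sum missingIn  ≡⟨ total ⟩
        sum₂ missing   ≤⟨ sum-mono-≤ (missing≤diff none) ⟩
        distance A B   ≤⟨ tight ⟩
        sum deficit    ∎)
        where open ≤-Reasoning

      rows-tight : ∀ i → sum (missing i) ≡ sum (diff i)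
      rows-tight = sum-squeeze (missing≤diff none) (begin
        distance A B   ≤⟨ tight ⟩
        sum deficit    ≤⟨ sum-mono-≤ deficit≤missing ⟩
        sum missingIn  ≡⟨ total ⟩
        sum₂ missing   ∎)
        where open ≤-Reasoning

      row-cases : ∀ i → (∀ j → missing i j ≡ diff i j) ⊎ (∀ j → extra i j ≡ diff i j)
      row-cases i with row-bounded none i
      ... | inj₁ missing≤ = inj₁ (sum-squeeze missing≤ (≤-reflexive (sym (rows-tight i))))
      ... | inj₂ extra≤   = inj₂ (sum-squeeze extra≤
        (≤-reflexive (sym (trans (sym (missing≡extra i)) (rows-tight i)))))

      -- A tight column with positive deficit has no room for extra units. Hence one missing unit
      -- forces every 1 of `A` in its column into `T`, and one extra unit forces every 0 of `A` in
      -- its column out of `T`.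
      no-cancellation : ∀ j → missingIn j ≡ 0 ⊎ extraIn j ≡ 0
      no-cancellation j with deficit-cases j
      ... | inj₁ d≡0 = inj₁ (trans (sym (columns-tight j)) d≡0)
      ... | inj₂ eq  = inj₂ (+-cancelʳ-≡ (deficit j) _ _ (trans eq (sym (columns-tight j))))

      missing⇒no-extra : ∀ {i j} → 0 < missing i j → ∀ a → extra a j ≡ 0
      missing⇒no-extra {i} {j} pos a with no-cancellation j
      ... | inj₁ zero-missing = contradiction (sym zero-missing) (<⇒≢ (positive-sum i pos))
      ... | inj₂ zero-extra   = n≤0⇒n≡0 (≮⇒≥ λ pos′ → <⇒≢ (positive-sum a pos′) (sym zero-extra))

      extra⇒no-missing : ∀ {i j} → 0 < extra i j → ∀ a → missing a j ≡ 0
      extra⇒no-missing {i} {j} pos a with no-cancellation j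
      ... | inj₂ zero-extra   = contradiction (sym zero-extra) (<⇒≢ (positive-sum i pos))
      ... | inj₁ zero-missing = n≤0⇒n≡0 (≮⇒≥ λ pos′ → <⇒≢ (positive-sum a pos′) (sym zero-missing))

      -- Meant for rows where `extra` and `diff` coincide: a missing cell has no extra units there,
      -- hence no difference. `full` serves the rows where `missing` and `diff` coincide.
      empty : ∀ i j → 0 < missing i j → diff i j ≡ 0 → T i j ≡ true × A i j ≡ false × B i j ≡ false
      empty i j pos zero-diff with T i j | A i j | B i j
      ... | true | false | false = refl , refl , refl
      ... | true | true  | true with () ← pos

      full : ∀ i j → 0 < extra i j → diff i j ≡ 0 → T i j ≡ false × A i j ≡ true × B i j ≡ true
      full i j pos zero-diff with T i j | A i j | B i j
      ... | false | true  | true = refl , refl , refl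
      ... | false | false | false with () ← pos

      inside : ∀ i j → extra i j ≡ 0 → A i j ≡ true → T i j ≡ true
      inside i j zero-extra Aij with T i j | A i j
      ... | true | true = refl

      outside : ∀ i j → missing i j ≡ 0 → A i j ≡ false → T i j ≡ false
      outside i j zero-missing Aij with T i j | A i j | B i j
      ... | false | false | _ = refl
      ... | true  | false | true  with () ← zero-missing
      ... | true  | false | false with () ← zero-missing

      extra-in-row : ∀ i j → 0 < missing i j → ∃[ k ] 0 < extra i k
      extra-in-row i j pos = sum-positive (subst (0 <_) (missing≡extra i) (positive-sum j pos))

      missing-in-row : ∀ i k → 0 < extra i k → ∃[ j ] 0 < missing i j
      missing-in-row i k pos = sum-positive (subst (0 <_) (sym (missing≡extra i)) (positive-sum k pos))

      -- By tightness the columns j and k force T = (1 , 0) in the row i′ found below, so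
      -- B = (0 , 1) is impossible there.  If B is constant on the two cells, the interchange
      -- keeps the distance, and the balance of row i′ supplies a cell completing an inversion.
      improve-at : ∀ {i j k} b → T i j ≡ true → T i k ≡ false →
        A i j ≡ false → A i k ≡ true → B i j ≡ b → B i k ≡ b → Better A B
      improve-at {i} {j} {k} b Tij Tik Aij Aik Bij Bik =
        let i′ , lt = sum-pigeonhole column-≤ i A-i
            Ai′j , Ai′k = one-zero _ _ lt
            Ti′j = inside i′ j (missing⇒no-extra missing-ij i′) Ai′j
            Ti′k = outside i′ k (extra⇒no-missing extra-ik i′) Ai′k
        in cases i′ _ _ Ai′j Ai′k Ti′j Ti′k refl refl
        where
        column-≤ : sum (λ a → [ A a k ]) ≤ sum (λ a → [ A a j ])
        column-≤ = subst₂ _≤_ (sym (columnSums LA k)) (sym (columnSums LA j)) (C-mono Tij Tik)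
        A-i : [ A i j ] < [ A i k ]
        A-i rewrite Aij | Aik = s≤s z≤n
        one-zero : ∀ a a′ → [ a′ ] < [ a ] → a ≡ true × a′ ≡ false
        one-zero true false _ = refl , refl
        one-zero true true (s≤s ())
        missing-ij : 0 < missing i j
        missing-ij rewrite Tij | Aij with B i j
        ... | false = s≤s z≤n
        ... | true  = s≤s z≤n
        extra-ik : 0 < extra i k
        extra-ik rewrite Tik | Aik = s≤s z≤n

        cases : ∀ i′ c c′ → A i′ j ≡ true → A i′ k ≡ false → T i′ j ≡ true → T i′ k ≡ false →
          B i′ j ≡ c → B i′ k ≡ c′ → Better A B
        cases i′ true false Ai′j Ai′k _ _ Bi′j Bi′k = by-gain b Bij Bik
          where
          by-gain : ∀ b → B i j ≡ b → B i k ≡ b → Better A B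
          by-gain false Bij Bik = gain LA LB Aij Aik Ai′j Ai′k Bij Bik Bi′j Bi′k
          by-gain true  Bij Bik = gain LA LB Aij Aik Ai′j Ai′k Bij Bik Bi′j Bi′k
        -- Both cells differ here, but `missing` vanishes at `k` and `extra` at `j`, against either
        -- alternative of `row-cases`.
        cases i′ false true Ai′j Ai′k Ti′j Ti′k Bi′j Bi′k with row-cases i′
        ... | inj₁ m≡d with eq ← m≡d k rewrite Ai′k | Ti′k | Bi′k with () ← eq
        ... | inj₂ e≡d with eq ← e≡d j rewrite Ai′j | Ti′j | Bi′j with () ← eq
        cases i′ false false Ai′j Ai′k Ti′j Ti′k Bi′j Bi′k with row-cases i′
        ... | inj₂ e≡d with eq ← e≡d j rewrite Ai′j | Ti′j | Bi′j with () ← eq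
        ... | inj₁ m≡d =
          -- The unit missing at `j` is balanced by an extra cell `k′`, which is full in both
          -- matrices. The interchange empties `j` in `A` too, so `j` and `k′` form an inversion.
          let k′ , extra-k′ = extra-in-row i′ j missing-i′j
              Tk′ , Ak′ , Bk′ = full i′ k′ extra-k′ (trans (sym (m≡d k′)) (extra⇒¬missing i′ k′ extra-k′))
              k′≢j = separate (T i′) Tk′ Ti′j
              k′≢k = ≢-sym (separate (A i′) Ai′k Ak′)
          in interchange-then LA LB b false Aij Aik Ai′j Ai′k Bij Bik Bi′j Bi′k
            (i′ , j , k′ , (Ti′j , Tk′) ,
             (A′-i′j , trans (other-column i′ k′ k′≢j k′≢k) Ak′) , (Bi′j , Bk′))
          where
          open Interchange A Aij Aik Ai′j Ai′k
          missing-i′j : 0 < missing i′ j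
          missing-i′j rewrite Ti′j | Ai′j | Bi′j = s≤s z≤n
        cases i′ true true Ai′j Ai′k Ti′j Ti′k Bi′j Bi′k with row-cases i′
        ... | inj₁ m≡d with eq ← m≡d k rewrite Ai′k | Ti′k | Bi′k with () ← eq
        ... | inj₂ e≡d =
          -- Dually, the interchange fills `k` in `A` too, and the extra unit at `k` is balanced by
          -- a cell `j′` of `T` empty in both matrices.
          let j′ , missing-j′ = missing-in-row i′ k extra-i′k
              Tj′ , Aj′ , Bj′ = empty i′ j′ missing-j′ (trans (sym (e≡d j′)) (missing⇒¬extra i′ j′ missing-j′))
              j′≢j = separate (A i′) Aj′ Ai′j
              j′≢k = ≢-sym (separate (T i′) Ti′k Tj′)
          in interchange-then LA LB b true Aij Aik Ai′j Ai′k Bij Bik Bi′j Bi′k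
            (i′ , j′ , k , (Tj′ , Ti′k) ,
             (trans (other-column i′ j′ j′≢j j′≢k) Aj′ , A′-i′k) , (Bj′ , Bi′k))
          where
          open Interchange A Aij Aik Ai′j Ai′k
          extra-i′k : 0 < extra i′ k
          extra-i′k rewrite Ti′k | Ai′k | Bi′k = s≤s z≤n

  -- Positive total deficit yields a missing cell `j`, and its row contains an extra cell `k`.
  -- Tightness makes `A` and `B` agree at one of them and differ at the other. So one matrix reads
  -- (0, 1) on `j`, `k` while the other is constant, which is the situation of `improve-at` up to
  -- swapping `A` and `B`.
  tight-better : ∀ A B → LineSums R C A → LineSums R C B →
    ¬ Inversion A B → distance A B ≤ sum deficit → 0 < sum deficit → Better A B
  tight-better A B LA LB none tight pos =
    let j , pos-j  = sum-positive (≤-trans pos (sum-mono-≤ deficit≤missing))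
        i , pos-ij = sum-positive pos-j
        k , pos-ik = extra-in-row i j pos-ij
    in from-row i j k pos-ij pos-ik (row-cases i)
    where
    open Excess A B LA LB
    open Tight none tight
    improve-swapped : ∀ {i j k} b → T i j ≡ true → T i k ≡ false →
      B i j ≡ false → B i k ≡ true → A i j ≡ b → A i k ≡ b → Better A B
    improve-swapped b Tij Tik Bij Bik Aij Aik = better-sym {A} {B}
      (Excess.Tight.improve-at B A LB LA (λ inversion → none (inversion-sym inversion))
        (subst (_≤ sum deficit) (distance-comm A B) tight) b Tij Tik Bij Bik Aij Aik)

    half-missing : ∀ i j → 0 < missing i j → 0 < diff i j →
      T i j ≡ true × ((A i j ≡ false × B i j ≡ true) ⊎ (B i j ≡ false × A i j ≡ true))
    half-missing i j pos pos′ with T i j | A i j | B i j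
    ... | true | false | true  = refl , inj₁ (refl , refl)
    ... | true | true  | false = refl , inj₂ (refl , refl)

    half-extra : ∀ i k → 0 < extra i k → 0 < diff i k →
      T i k ≡ false × ((A i k ≡ true × B i k ≡ false) ⊎ (B i k ≡ true × A i k ≡ false))
    half-extra i k pos pos′ with T i k | A i k | B i k
    ... | false | false | true  = refl , inj₂ (refl , refl)
    ... | false | true  | false = refl , inj₁ (refl , refl)

    from-row : ∀ i j k → 0 < missing i j → 0 < extra i k →
      (∀ l → missing i l ≡ diff i l) ⊎ (∀ l → extra i l ≡ diff i l) → Better A B
    from-row i j k pos-ij pos-ik (inj₁ m≡d)
      with full i k pos-ik (trans (sym (m≡d k)) (extra⇒¬missing i k pos-ik))
         | half-missing i j pos-ij (subst (0 <_) (m≡d j) pos-ij)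
    ... | Tik , Aik , Bik | Tij , inj₁ (Aij , Bij) = improve-at true Tij Tik Aij Aik Bij Bik
    ... | Tik , Aik , Bik | Tij , inj₂ (Bij , Aij) = improve-swapped true Tij Tik Bij Bik Aij Aik
    from-row i j k pos-ij pos-ik (inj₂ e≡d)
      with empty i j pos-ij (trans (sym (e≡d j)) (missing⇒¬extra i j pos-ij))
         | half-extra i k pos-ik (subst (0 <_) (e≡d k) pos-ik)
    ... | Tij , Aij , Bij | Tik , inj₁ (Aik , Bik) = improve-at false Tij Tik Aij Aik Bij Bik
    ... | Tij , Aij , Bij | Tik , inj₂ (Bik , Aik) = improve-swapped false Tij Tik Bij Bik Aij Aik

  improve : ∀ {A B} → LineSums R C A → LineSums R C B →
    0 < sum deficit → distance A B ≤ sum deficit → Better A B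
  improve {A} {B} LA LB pos small with inversion? A B
  ... | yes inversion = resolve-inversion LA LB inversion
  ... | no  none      = tight-better A B LA LB none small pos

-- Parity, iteration, and the case α = 0.

[]-injective : ∀ {a b} → [ a ] ≡ [ b ] → a ≡ b
[]-injective {false} {false} _ = refl
[]-injective {true}  {true}  _ = refl

halves-≤ : ∀ a b → a + a < b + b + 2 → a ≤ b
halves-≤ a b lt = ≮⇒≥ λ b<a → <⇒≱ lt (begin
  b + b + 2      ≡⟨ solve 1 (λ b → b :+ b :+ con 2 := (con 1 :+ b) :+ (con 1 :+ b)) refl b ⟩
  suc b + suc b  ≤⟨ +-mono-≤ b<a b<a ⟩
  a + a          ∎)
  where
  open ≤-Reasoning
  open +-*-Solver

-- Since the row sums agree, each row has as many cells in `A` alone as in `B` alone.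
distance-even : ∀ {R : Vector ℕ m} {C : Vector ℕ n} {A B} → LineSums R C A → LineSums R C B →
  distance A B ≡ sum₂ (λ i j → [ one-sided A B i j ]) + sum₂ (λ i j → [ one-sided A B i j ])
distance-even {R = R} {A = A} {B} LA LB = begin
  distance A B                          ≡⟨ sum₂-cong (λ i j → cells (A i j) (B i j)) ⟩
  sum₂ (λ i j → A∖B i j + B∖A i j)      ≡⟨ sum₂-+ A∖B B∖A ⟩
  sum₂ A∖B + sum₂ B∖A                   ≡⟨ cong (sum₂ A∖B +_) (sum-cong-≗ same) ⟨
  sum₂ A∖B + sum₂ A∖B                   ∎
  where
  open ≡-Reasoning
  A∖B B∖A : _ → _ → ℕ
  A∖B i j = [ one-sided A B i j ]
  B∖A i j = [ one-sided B A i j ]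
  cells : ∀ a b → [ a xor b ] ≡ [ a ∧ not b ] + [ b ∧ not a ]
  cells false false = refl
  cells false true  = refl
  cells true  false = refl
  cells true  true  = refl
  union : ∀ a b → [ a ∧ not b ] + [ b ] ≡ [ b ∧ not a ] + [ a ]
  union false false = refl
  union false true  = refl
  union true  false = refl
  union true  true  = refl
  same : ∀ i → sum (A∖B i) ≡ sum (B∖A i)
  same i = +-cancelʳ-≡ (R i) _ _ (begin
    sum (A∖B i) + R i                      ≡⟨ cong (sum (A∖B i) +_) (rowSums LB i) ⟨
    sum (A∖B i) + sum (λ j → [ B i j ])    ≡⟨ ∑-distrib-+ (A∖B i) _ ⟨
    sum (λ j → A∖B i j + [ B i j ])        ≡⟨ sum-cong-≗ (λ j → union (A i j) (B i j)) ⟩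
    sum (λ j → B∖A i j + [ A i j ])        ≡⟨ ∑-distrib-+ (B∖A i) _ ⟩
    sum (B∖A i) + sum (λ j → [ A i j ])    ≡⟨ cong (sum (B∖A i) +_) (rowSums LA i) ⟩
    sum (B∖A i) + R i                      ∎)

discrepancy : Vector ℕ m → Vector ℕ n → ℕ
discrepancy R C = sum (λ j → ∣ C j - v R j ∣)

module Existence {m n} (R : Vector ℕ m) (C : Vector ℕ n)
  (C-antitone : NonIncreasing C) (A₀ : Matrix m n) (LA₀ : LineSums R C A₀) where

  R≤n : ∀ i → R i ≤ n
  R≤n i = begin
    R i                            ≡⟨ rowSums LA₀ i ⟨
    sum (λ j → [ A₀ i j ])         ≤⟨ sum-mono-≤ (λ j → bit≤1 (A₀ i j)) ⟩
    sum {n} (λ _ → 1)              ≡⟨ sum-one n ⟩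
    n                              ∎
    where
    open ≤-Reasoning
    bit≤1 : ∀ b → [ b ] ≤ 1
    bit≤1 false = z≤n
    bit≤1 true  = ≤-refl

  open Exchange R C C-antitone R≤n

  sum-C : sum C ≡ sum R
  sum-C = begin
    sum C                                  ≡⟨ sum-cong-≗ (columnSums LA₀) ⟨
    sum (λ j → sum (λ i → [ A₀ i j ]))     ≡⟨ ∑-comm (λ i j → [ A₀ i j ]) ⟨
    sum (λ i → sum (λ j → [ A₀ i j ]))     ≡⟨ sum-cong-≗ (rowSums LA₀) ⟩
    sum R                                  ∎
    where open ≡-Reasoning

  sum-v : sum {n} (v R) ≡ sum R
  sum-v = begin
    sum {n} (v R)                          ≡⟨ sum-cong-≗ {n} (ferrers-columns R) ⟨
    sum (λ j → sum (λ i → [ T i j ]))      ≡⟨ ∑-comm (λ i j → [ T i j ]) ⟨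
    sum (λ i → sum (λ j → [ T i j ]))      ≡⟨ sum-cong-≗ T-row ⟩
    sum R                                  ∎
    where open ≡-Reasoning

  surplus shortage : Vector ℕ n
  surplus  j = C j ∸ v R j
  shortage j = v R j ∸ C j

  -- `C` and `v R` have the same total `sum R`, so the positive and negative parts of their
  -- difference balance. Hence the sum of absolute values is twice `sum shortage`.
  surplus≡shortage : sum surplus ≡ sum shortage
  surplus≡shortage = +-cancelʳ-≡ (sum R) _ _ (begin
    sum surplus + sum R               ≡⟨ cong (sum surplus +_) sum-v ⟨
    sum surplus + sum {n} (v R)           ≡⟨ ∑-distrib-+ surplus (v R) ⟨
    sum (λ j → surplus j + v R j)     ≡⟨ sum-cong-≗ (λ j → ∸-+-comm (C j) (v R j)) ⟩
    sum (λ j → shortage j + C j)      ≡⟨ ∑-distrib-+ shortage C ⟩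
    sum shortage + sum C              ≡⟨ cong (sum shortage +_) sum-C ⟩
    sum shortage + sum R              ∎)
    where open ≡-Reasoning

  sum-deficit : sum deficit ≡ sum shortage + sum shortage
  sum-deficit = ∑-distrib-+ shortage shortage

  discrepancy≡deficit : discrepancy R C ≡ sum deficit
  discrepancy≡deficit = begin
    discrepancy R C                        ≡⟨ sum-cong-≗ (λ j → ∣-∣≡∸+∸ (C j) (v R j)) ⟩
    sum (λ j → surplus j + shortage j)     ≡⟨ ∑-distrib-+ surplus shortage ⟩
    sum surplus + sum shortage             ≡⟨ cong (_+ sum shortage) surplus≡shortage ⟩
    sum shortage + sum shortage            ≡⟨ sum-deficit ⟨
    sum deficit                            ∎
    where open ≡-Reasoning

  -- Both numbers are even, so no value lies strictly between `sum deficit` and `sum deficit + 2`.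
  small-distance : ∀ {A B} → LineSums R C A → LineSums R C B →
    distance A B < sum deficit + 2 → distance A B ≤ sum deficit
  small-distance {A} {B} LA LB lt rewrite sum-deficit | distance-even LA LB = +-mono-≤ half half
    where half = halves-≤ (sum₂ λ i j → [ one-sided A B i j ]) (sum shortage) lt

  Far : Set
  Far = ∃[ A ] ∃[ B ] LineSums R C A × LineSums R C B × sum deficit + 2 ≤ distance A B

  -- Each improvement costs one unit of `fuel` and raises the distance by at least one, so the bound
  -- is an invariant. With no fuel left it is the desired inequality.
  climb : 0 < sum deficit → ∀ fuel {A B} → LineSums R C A → LineSums R C B →
    sum deficit + 2 ≤ distance A B + fuel → Far
  climb pos zero {A} {B} LA LB bound =
    A , B , LA , LB , subst (sum deficit + 2 ≤_) (+-identityʳ _) bound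
  climb pos (suc fuel) {A} {B} LA LB bound with sum deficit + 2 ≤? distance A B
  ... | yes far = A , B , LA , LB , far
  ... | no  near
    with A′ , B′ , LA′ , LB′ , lt ← improve LA LB pos (small-distance LA LB (≰⇒> near)) =
    climb pos fuel LA′ LB′ (begin
      sum deficit + 2            ≤⟨ bound ⟩
      distance A B + suc fuel    ≡⟨ +-suc (distance A B) fuel ⟩
      suc (distance A B) + fuel  ≤⟨ +-monoˡ-≤ fuel lt ⟩
      distance A′ B′ + fuel      ∎)
    where open ≤-Reasoning

  far-apart : 0 < discrepancy R C →
    ∃[ A ] ∃[ B ] LineSums R C A × LineSums R C B × discrepancy R C + 2 ≤ distance A B
  far-apart pos rewrite discrepancy≡deficit =
    -- Starting from two equal matrices, fuel equal to the target distance suffices.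
    climb pos (sum deficit + 2) LA₀ LA₀ (m≤n+m (sum deficit + 2) (distance A₀ A₀))

  module Balanced (balanced : discrepancy R C ≡ 0) where

    v≡C : ∀ (j : Fin n) → v R j ≡ C j
    v≡C j = sym (∣m-n∣≡0⇒m≡n (n≤0⇒n≡0 (≮⇒≥ λ pos → <⇒≢ (positive-sum j pos) (sym balanced))))

    module _ {A : Matrix m n} (LA : LineSums R C A) where

      -- Induction over the columns from left to right, with `t` making it structural. A 1 of `A` at
      -- `i`, `j` outside `T` would come on top of all cells of `T` in row `i`, which lie further
      -- left and belong to `A` by induction; the row sum would exceed `R i`. So column `j` of `A`
      -- lies inside that of `T`, and equal column sums make them coincide.
      columns-agree : ∀ t (j : Fin n) → toℕ j < t → ∀ i → A i j ≡ T i j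
      columns-agree (suc t) j (s≤s j≤t) i = []-injective (sum-squeeze bound same i)
        where
        bound : ∀ i → [ A i j ] ≤ [ T i j ]
        bound i with A i j in Aij | T i j in Tij
        ... | false | _     = z≤n
        ... | true  | true  = ≤-refl
        ... | true  | false = contradiction (sum-mono-< covered j at-j)
                (<-irrefl (trans (T-row i) (sym (rowSums LA i))))
          where
          covered : ∀ l → [ T i l ] ≤ [ A i l ]
          covered l with T i l in Til
          ... | false = z≤n
          ... | true  = ≤-reflexive (cong [_] (trans (sym Til)
                  (sym (columns-agree t l (<-≤-trans (ferrers-< R Til Tij) j≤t) i))))
          at-j : [ T i j ] < [ A i j ]
          at-j rewrite Aij | Tij = s≤s z≤n
        same : sum (λ i → [ T i j ]) ≤ sum (λ i → [ A i j ])
        same = ≤-reflexive (trans (ferrers-columns R j) (trans (v≡C j) (sym (columnSums LA j))))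

      is-ferrers : ∀ i j → A i j ≡ T i j
      is-ferrers i j = columns-agree (suc (toℕ j)) j ≤-refl i

-- Translation between finite sets of points and matrices.

does-≟-true : ∀ b → does (b Bool.≟ true) ≡ b
does-≟-true false = refl
does-≟-true true  = refl

-- Duplicate-free lists with the same members are permutations of each other, so `xs` can be
-- replaced by the image of the selected indices.
length≡count : ∀ {k a} {A : Set a} (f : Fin k → A) → (∀ {i j} → f i ≡ f j → i ≡ j) →
  (b : Fin k → Bool) {xs : List A} → Unique xs →
  (∀ {x} → x Membership.∈ xs → ∃[ i ] x ≡ f i × b i ≡ true) →
  (∀ i → b i ≡ true → f i Membership.∈ xs) →
  length xs ≡ sum (λ i → [ b i ])
length≡count {k} f f-injective b {xs} xs! covered sound = begin
  length xs                                  ≡⟨ ↭-length (∼bag⇒↭ (unique∧set⇒bag xs! ys! same)) ⟩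
  length (map f (filter b? (allFin k)))      ≡⟨ length-map f (filter b? (allFin k)) ⟩
  length (filter b? (allFin k))              ≡⟨ length-filter-tabulate b? id ⟩
  sum (λ i → [ does (b? i) ])                ≡⟨ sum-cong-≗ (λ i → cong [_] (does-≟-true (b i))) ⟩
  sum (λ i → [ b i ])                        ∎
  where
  open ≡-Reasoning
  b? : ∀ i → Dec (b i ≡ true)
  b? i = b i Bool.≟ true
  ys! : Unique (map f (filter b? (allFin k)))
  ys! = Unique.map⁺ f-injective (Unique.filter⁺ b? (Unique.allFin⁺ k))
  same : ∀ {x} → x Membership.∈ xs ⇔ x Membership.∈ map f (filter b? (allFin k))
  same {x} = mk⇔
    (λ x∈xs → let i , x≡fi , bi = covered x∈xs in
      ∈-map∘filter⁺ f b? {f = f} (i , ∈-allFin i , x≡fi , bi))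
    (λ x∈ys → let i , _ , x≡fi , bi = ∈-map∘filter⁻ f b? {f = f} {xs = allFin k} x∈ys in
      subst (Membership._∈ xs) (sym x≡fi) (sound i bi))

number-injective : {i j : Fin n} → ℤ.+ number i ≡ ℤ.+ number j → i ≡ j
number-injective eq = Fin.toℕ-injective (suc-injective (ℤ.+-injective eq))

number-in-range : ∀ (i : Fin n) → 1ℤ ℤ.≤ ℤ.+ number i × ℤ.+ number i ℤ.≤ ℤ.+ n
number-in-range i = ℤ.+≤+ (s≤s z≤n) , ℤ.+≤+ (Fin.toℕ<n i)

in-range : ∀ {x} → 1ℤ ℤ.≤ x × x ℤ.≤ ℤ.+ n → ∃[ i ] x ≡ ℤ.+ number {n} i
in-range {x = ℤ.+ suc x} (_ , ℤ.+≤+ x<n) = fromℕ< x<n , cong (λ y → ℤ.+ suc y) (sym (Fin.toℕ-fromℕ< x<n))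
in-range {x = ℤ.+ zero} (ℤ.+≤+ () , _)

in-range? : ∀ n x → Dec (1ℤ ℤ.≤ x × x ℤ.≤ ℤ.+ n)
in-range? n x = (1ℤ ℤ.≤? x) ×-dec (x ℤ.≤? ℤ.+ n)

point : Fin m → Fin n → Point
point i j = ℤ.+ number i , ℤ.+ number j

-- A relation, because many lists stand for one set: it applies to `fromMatrix A`, to an arbitrary
-- solution and to a symmetric difference alike.
record Represents (A : Matrix m n) (F : FiniteSet) : Set where
  field
    covered : ∀ {p} → p ∈ F → ∃[ i ] ∃[ j ] p ≡ point i j × A i j ≡ true
    sound   : ∀ i j → A i j ≡ true → point i j ∈ F

open Represents

point-injective : {i i′ : Fin m} {j j′ : Fin n} → point i j ≡ point i′ j′ → i ≡ i′ × j ≡ j′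
point-injective eq = number-injective (cong proj₁ eq) , number-injective (cong proj₂ eq)

complete : ∀ {A : Matrix m n} {F} → Represents A F → ∀ i j → point i j ∈ F → A i j ≡ true
complete rep i j p∈F with i′ , j′ , eq , Aij ← covered rep p∈F
  with refl , refl ← point-injective {i = i} {i′} {j} {j′} eq = Aij

inRow? : ∀ x (p : Point) → Dec (proj₁ p ≡ x)
inRow? x p = proj₁ p ℤ.≟ x

inColumn? : ∀ y (p : Point) → Dec (proj₂ p ≡ y)
inColumn? y p = proj₂ p ℤ.≟ y

rowSum-represented : ∀ {A : Matrix m n} {F} → Represents A F →
  ∀ i → rowSum F (ℤ.+ number i) ≡ sum (λ j → [ A i j ])
rowSum-represented {A = A} {F} rep i = length≡count (point i) (proj₂ ∘ point-injective {i = i} {i}) (A i)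
  (Unique.filter⁺ P? (unique F))
  (λ p∈ → let p∈F , p-row = ∈-filter⁻ P? {xs = elements F} p∈
              i′ , j , p≡ , Aij = covered rep p∈F
              i′≡i = number-injective (trans (sym (cong proj₁ p≡)) p-row)
          in j , trans p≡ (cong (λ i → point i j) i′≡i) , trans (cong (λ i → A i j) (sym i′≡i)) Aij)
  (λ j Aij → ∈-filter⁺ P? (sound rep i j Aij) refl)
  where P? = inRow? (ℤ.+ number i)

columnSum-represented : ∀ {A : Matrix m n} {F} → Represents A F →
  ∀ j → columnSum F (ℤ.+ number j) ≡ sum (λ i → [ A i j ])
columnSum-represented {A = A} {F} rep j = length≡count (λ i → point i j) (proj₁ ∘ point-injective {j = j} {j}) (λ i → A i j)
  (Unique.filter⁺ P? (unique F))
  (λ p∈ → let p∈F , p-column = ∈-filter⁻ P? {xs = elements F} p∈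
              i , j′ , p≡ , Aij = covered rep p∈F
              j′≡j = number-injective (trans (sym (cong proj₂ p≡)) p-column)
          in i , trans p≡ (cong (point i) j′≡j) , trans (cong (A i) (sym j′≡j)) Aij)
  (λ i Aij → ∈-filter⁺ P? (sound rep i j Aij) refl)
  where P? = inColumn? (ℤ.+ number j)

fromMatrix : Matrix m n → FiniteSet
fromMatrix {m} {n} A = mkFiniteSet
  (map (λ (i , j) → point i j) (filter (λ (i , j) → A i j Bool.≟ true) (cartesianProduct (allFin m) (allFin n))))
  (Unique.map⁺ (λ {(i , j)} {(i′ , j′)} eq → let i≡ , j≡ = point-injective {i = i} {i′} {j} {j′} eq in cong₂ _,_ i≡ j≡)
    (Unique.filter⁺ (λ (i , j) → A i j Bool.≟ true)
      (Unique.cartesianProduct⁺ (Unique.allFin⁺ m) (Unique.allFin⁺ n))))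

fromMatrix-represents : (A : Matrix m n) → Represents A (fromMatrix A)
fromMatrix-represents {m} {n} A = record
  { covered = λ p∈ → let (i , j) , _ , p≡ , Aij = ∈-map∘filter⁻ f A? {f = f} {xs = cartesianProduct (allFin m) (allFin n)} p∈
                     in i , j , p≡ , Aij
  ; sound   = λ i j Aij → ∈-map∘filter⁺ f A? {f = f} ((i , j) , ∈-cartesianProduct⁺ (∈-allFin i) (∈-allFin j) , refl , Aij)
  }
  where
  f : Fin m × Fin n → Point
  f (i , j) = point i j
  A? : ∀ (ij : Fin m × Fin n) → Dec (A (proj₁ ij) (proj₂ ij) ≡ true)
  A? (i , j) = A i j Bool.≟ true

fromMatrix-lineSums : ∀ {R : Vector ℕ m} {C : Vector ℕ n} {A} → LineSums R C A → HasLineSums R C (fromMatrix A)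
fromMatrix-lineSums {R = R} {C} {A} LA = record
  { rows         = λ i → trans (rowSum-represented rep i) (rowSums LA i)
  ; columns      = λ j → trans (columnSum-represented rep j) (columnSums LA j)
  ; otherRows    = λ x out → cong length (filter-none (inRow? x) (All.tabulate λ p∈ p-row →
      let i , j , p≡ , _ = covered rep p∈
      in out (subst (λ y → 1ℤ ℤ.≤ y × y ℤ.≤ _) (trans (sym (cong proj₁ p≡)) p-row) (number-in-range i))))
  ; otherColumns = λ y out → cong length (filter-none (inColumn? y) (All.tabulate λ p∈ p-column →
      let i , j , p≡ , _ = covered rep p∈
      in out (subst (λ y → 1ℤ ℤ.≤ y × y ℤ.≤ _) (trans (sym (cong proj₂ p≡)) p-column) (number-in-range j))))
  }
  where rep = fromMatrix-represents A

-- Only an `m` by `n` window is read; for a set with the given line sums, `in-rows` and `in-columns`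
-- show that nothing is lost.
matrix : FiniteSet → Matrix m n
matrix F i j = does (point i j ∈? elements F)

module _ {R : Vector ℕ m} {C : Vector ℕ n} {F : FiniteSet} (sums : HasLineSums R C F) where
  open HasLineSums sums

  -- A point outside the range would make the sum of its row positive, against `otherRows`.
  in-rows : ∀ {p} → p ∈ F → ∃[ i ] proj₁ p ≡ ℤ.+ number {m} i
  in-rows {p} p∈F with in-range? m (proj₁ p)
  ... | yes range = in-range range
  ... | no  out   = contradiction (otherRows (proj₁ p) out) (<⇒≢ (filter-some (inRow? (proj₁ p)) (Membership.lose p∈F refl)) ∘ sym)

  in-columns : ∀ {p} → p ∈ F → ∃[ j ] proj₂ p ≡ ℤ.+ number {n} j
  in-columns {p} p∈F with in-range? n (proj₂ p)
  ... | yes range = in-range range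
  ... | no  out   = contradiction (otherColumns (proj₂ p) out) (<⇒≢ (filter-some (inColumn? (proj₂ p)) (Membership.lose p∈F refl)) ∘ sym)

  matrix-represents : Represents {m} {n} (matrix F) F
  matrix-represents = record
    { covered = λ p∈F → let i , x≡ = in-rows p∈F ; j , y≡ = in-columns p∈F ; p≡ = cong₂ _,_ x≡ y≡ in
        i , j , p≡ , dec-true (point i j ∈? elements F) (subst (_∈ F) p≡ p∈F)
    ; sound   = λ i j → from-does i j
    }
    where
    from-does : ∀ i j → matrix {m} {n} F i j ≡ true → point i j ∈ F
    from-does i j eq with point i j ∈? elements F
    ... | yes p∈F = p∈F

  matrix-lineSums : LineSums R C (matrix F)
  matrix-lineSums = lineSums
    (λ i → trans (sym (rowSum-represented matrix-represents i)) (rows i))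
    (λ j → trans (sym (columnSum-represented matrix-represents j)) (columns j))

represents-≐ : ∀ {A B : Matrix m n} {F G} → Represents A F → Represents B G → (∀ i j → A i j ≡ B i j) → F ≐ G
represents-≐ {A = A} {B} {F} {G} repA repB A≡B p = mk⇔ (to repA repB A≡B) (to repB repA (λ i j → sym (A≡B i j)))
  where
  to : ∀ {A B : Matrix _ _} {F G} → Represents A F → Represents B G → (∀ i j → A i j ≡ B i j) → p ∈ F → p ∈ G
  to {G = G} repA repB A≡B p∈F with i , j , p≡ , Aij ← covered repA p∈F =
    subst (_∈ G) (sym p≡) (sound repB i j (trans (sym (A≡B i j)) Aij))

△-represents : ∀ {A B : Matrix m n} {F G} → Represents A F → Represents B G →
  Represents (λ i j → A i j xor B i j) (F △ G)
△-represents {A = A} {B} {F} {G} repA repB = record { covered = cover ; sound = λ i j → member i j }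
  where
  cover : ∀ {p} → p ∈ F △ G → ∃[ i ] ∃[ j ] p ≡ point i j × (A i j xor B i j) ≡ true
  cover p∈ with ∈-++⁻ (elements (F ∖ G)) p∈
  ... | inj₁ p∈F∖G with p∈F , p∉G ← ∈-filter⁻ (_∉? G) {xs = elements F} p∈F∖G
    with i , j , refl , Aij ← covered repA p∈F = i , j , refl , xor-true
    where
    xor-true : (A i j xor B i j) ≡ true
    xor-true rewrite Aij with B i j in Bij
    ... | false = refl
    ... | true  = contradiction (sound repB i j Bij) p∉G
  cover p∈ | inj₂ p∈G∖F with p∈G , p∉F ← ∈-filter⁻ (_∉? F) {xs = elements G} p∈G∖F
    with i , j , refl , Bij ← covered repB p∈G = i , j , refl , xor-true
    where
    xor-true : (A i j xor B i j) ≡ true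
    xor-true rewrite Bij with A i j in Aij
    ... | false = refl
    ... | true  = contradiction (sound repA i j Aij) p∉F
  member : ∀ i j → (A i j xor B i j) ≡ true → point i j ∈ F △ G
  member i j eq with A i j in Aij | B i j in Bij
  ... | true  | false = ∈-++⁺ˡ (∈-filter⁺ (_∉? G) (sound repA i j Aij)
                          (λ p∈G → false≢true Bij (complete repB i j p∈G)))
  ... | false | true  = ∈-++⁺ʳ (elements (F ∖ G)) (∈-filter⁺ (_∉? F) (sound repB i j Bij)
                          (λ p∈F → false≢true Aij (complete repA i j p∈F)))

-- Cardinality as a sum over rows.

length-filter-∷ : ∀ {a p} {A : Set a} {P : Pred A p} (P? : Decidable P) x xs →
  length (filter P? (x ∷ xs)) ≡ [ does (P? x) ] + length (filter P? xs)
length-filter-∷ P? x xs with does (P? x)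
... | true  = refl
... | false = refl

sum-indicator : ∀ (i : Fin n) (b : Fin n → Bool) → b i ≡ true → (∀ j → b j ≡ true → j ≡ i) → sum (λ j → [ b j ]) ≡ 1
sum-indicator i b bi only = sym (length≡count id id b {i ∷ []} (All.[] ∷ [])
  (λ { (here refl) → i , refl , bi }) (λ j bj → here (only j bj)))

-- Each point lies in exactly one numbered row, so it raises exactly one summand by one.
length≡sum-rows : ∀ (xs : List Point) → (∀ {p} → p Membership.∈ xs → ∃[ i ] proj₁ p ≡ ℤ.+ number {m} i) →
  length xs ≡ sum {m} (λ i → length (filter (inRow? (ℤ.+ number i)) xs))
length≡sum-rows {m} []       inside = sym (sum-zero m)
length≡sum-rows {m} (p ∷ xs) inside with i , p-row ← inside (here refl) = begin
  suc (length xs)                   ≡⟨ cong₂ _+_ (sym one) (length≡sum-rows xs (inside ∘ there)) ⟩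
  sum head + sum tail               ≡⟨ ∑-distrib-+ head tail ⟨
  sum (λ i → head i + tail i)       ≡⟨ sum-cong-≗ {m} (λ i → length-filter-∷ (inRow? (ℤ.+ number i)) p xs) ⟨
  sum {m} (λ i → length (filter (inRow? (ℤ.+ number i)) (p ∷ xs))) ∎
  where
  open ≡-Reasoning
  head tail : Vector ℕ m
  head i = [ does (inRow? (ℤ.+ number i) p) ]
  tail i = length (filter (inRow? (ℤ.+ number i)) xs)
  only : ∀ j → does (inRow? (ℤ.+ number j) p) ≡ true → j ≡ i
  only j eq with proj₁ p ℤ.≟ ℤ.+ number j
  ... | yes p-row′ = number-injective (trans (sym p-row′) p-row)
  one : sum head ≡ 1
  one = sum-indicator i (λ j → does (inRow? (ℤ.+ number j) p)) (dec-true (inRow? (ℤ.+ number i) p) p-row) only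

card-represented : ∀ {A : Matrix m n} {F} → Represents A F → card F ≡ sum₂ (λ i j → [ A i j ])
card-represented {A = A} {F} rep = trans
  (length≡sum-rows (elements F) (λ p∈F → let i , j , p≡ , _ = covered rep p∈F in i , cong proj₁ p≡))
  (sum-cong-≗ (rowSum-represented rep))

card-lineSums : ∀ {R : Vector ℕ m} {C : Vector ℕ n} {F} → HasLineSums R C F → card F ≡ sum R
card-lineSums {F = F} sums = trans (length≡sum-rows (elements F) (in-rows sums)) (sum-cong-≗ (HasLineSums.rows sums))

-- Rational arithmetic for α.

toℚᵘ-fromℕ : ∀ k → ℚ.toℚᵘ (fromℕ k) ℚᵘ.≃ mkℚᵘ (ℤ.+ k) 0
toℚᵘ-fromℕ k = ℚ.toℚᵘ-fromℚᵘ (mkℚᵘ (ℤ.+ k) 0)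

-- `fromℕ` passes through a normalisation by the gcd. The computation is therefore done with
-- unnormalised fractions of denominator 1, which `mkℚᵘ` stores as 0.
fromℕ-+ : ∀ a b → fromℕ a ℚ.+ fromℕ b ≡ fromℕ (a + b)
fromℕ-+ a b = ℚ.toℚᵘ-injective (begin
  ℚ.toℚᵘ (fromℕ a ℚ.+ fromℕ b)               ≈⟨ ℚ.toℚᵘ-homo-+ (fromℕ a) (fromℕ b) ⟩
  ℚ.toℚᵘ (fromℕ a) ℚᵘ.+ ℚ.toℚᵘ (fromℕ b)     ≈⟨ ℚᵘ.+-cong (toℚᵘ-fromℕ a) (toℚᵘ-fromℕ b) ⟩
  mkℚᵘ (ℤ.+ a) 0 ℚᵘ.+ mkℚᵘ (ℤ.+ b) 0             ≈⟨ *≡* (cong (ℤ._* 1ℤ) (cong₂ ℤ._+_ (ℤ.*-identityʳ (ℤ.+ a)) (ℤ.*-identityʳ (ℤ.+ b)))) ⟩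
  mkℚᵘ (ℤ.+ (a + b)) 0                         ≈⟨ toℚᵘ-fromℕ (a + b) ⟨
  ℚ.toℚᵘ (fromℕ (a + b))                     ∎)
  where open ℚᵘ.≃-Reasoning

fromℕ-mono-≤ : ∀ {a b} → a ≤ b → fromℕ a ℚ.≤ fromℕ b
fromℕ-mono-≤ {a} {b} a≤b = ℚ.toℚᵘ-cancel-≤ (begin
  ℚ.toℚᵘ (fromℕ a)  ≃⟨ toℚᵘ-fromℕ a ⟩
  mkℚᵘ (ℤ.+ a) 0      ≤⟨ *≤* (ℤ.*-monoʳ-≤-nonNeg 1ℤ (ℤ.+≤+ a≤b)) ⟩
  mkℚᵘ (ℤ.+ b) 0      ≃⟨ toℚᵘ-fromℕ b ⟨
  ℚ.toℚᵘ (fromℕ b)  ∎)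
  where open ℚᵘ.≤-Reasoning

2α+2 : ∀ (R : Vector ℕ m) (C : Vector ℕ n) → fromℕ 2 ℚ.* α R C ℚ.+ fromℕ 2 ≡ fromℕ (discrepancy R C + 2)
2α+2 R C = begin
  fromℕ 2 ℚ.* (½ ℚ.* S) ℚ.+ fromℕ 2   ≡⟨ cong (ℚ._+ fromℕ 2) (ℚ.*-assoc (fromℕ 2) ½ S) ⟨
  -- The closed factor `fromℕ 2 ℚ.* ½` evaluates to 1.
  fromℕ 2 ℚ.* ½ ℚ.* S ℚ.+ fromℕ 2     ≡⟨ cong (ℚ._+ fromℕ 2) (ℚ.*-identityˡ S) ⟩
  S ℚ.+ fromℕ 2                       ≡⟨ fromℕ-+ (discrepancy R C) 2 ⟩
  fromℕ (discrepancy R C + 2)         ∎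
  where
  open ≡-Reasoning
  S = fromℕ (discrepancy R C)

half-double : ∀ a → ½ ℚ.* fromℕ (a + a) ≡ fromℕ a
half-double a = begin
  ½ ℚ.* fromℕ (a + a)                    ≡⟨ cong (½ ℚ.*_) (fromℕ-+ a a) ⟨
  ½ ℚ.* (fromℕ a ℚ.+ fromℕ a)            ≡⟨ ℚ.*-distribˡ-+ ½ (fromℕ a) (fromℕ a) ⟩
  ½ ℚ.* fromℕ a ℚ.+ ½ ℚ.* fromℕ a        ≡⟨ ℚ.*-distribʳ-+ (fromℕ a) ½ ½ ⟨
  (½ ℚ.+ ½) ℚ.* fromℕ a                  ≡⟨ ℚ.*-identityˡ (fromℕ a) ⟩
  fromℕ a                                ∎
  where open ≡-Reasoning

-- The lower bound for finite sets.

balanced⇒unique : ∀ (R : Vector ℕ m) (C : Vector ℕ n) → NonIncreasing C →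
  Consistent R C → discrepancy R C ≡ 0 → UniquelyDetermine R C
balanced⇒unique {m} {n} R C C-antitone (F , sums) balanced = F , sums , λ {G} sums′ →
  represents-≐ (matrix-represents sums) (matrix-represents sums′)
    (λ i j → trans (is-ferrers (matrix-lineSums sums) i j) (sym (is-ferrers (matrix-lineSums sums′) i j)))
  where
  open Existence R C C-antitone (matrix F) (matrix-lineSums sums)
  open Balanced balanced

-- Non-uniqueness excludes discrepancy 0 by `balanced⇒unique`, and then `far-apart` applies.
lower-bound : ∀ (R : Vector ℕ m) (C : Vector ℕ n) → NonIncreasing C →
  Consistent R C → ¬ UniquelyDetermine R C →
  ∃[ F₂ ] ∃[ F₃ ] HasLineSums R C F₂ × HasLineSums R C F₃ × discrepancy R C + 2 ≤ card (F₂ △ F₃)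
lower-bound R C C-antitone (F , sums) not-unique =
  let A , B , LA , LB , far = far-apart (n≢0⇒n>0 (λ balanced →
        not-unique (balanced⇒unique R C C-antitone (F , sums) balanced)))
  in fromMatrix A , fromMatrix B , fromMatrix-lineSums LA , fromMatrix-lineSums LB ,
     subst (discrepancy R C + 2 ≤_)
       (sym (card-represented (△-represents (fromMatrix-represents A) (fromMatrix-represents B)))) far
  where open Existence R C C-antitone (matrix F) (matrix-lineSums sums)

card-△ : ∀ F G → card (F △ G) ≤ card F + card G
card-△ F G = begin
  card (F △ G)                 ≡⟨ length-++ (elements (F ∖ G)) ⟩
  card (F ∖ G) + card (G ∖ F)  ≤⟨ +-mono-≤ (length-filter (_∉? G) (elements F)) (length-filter (_∉? F) (elements G)) ⟩
  card F + card G              ∎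
  where open ≤-Reasoning

-- Sharpness.

ones : ∀ n → Vector ℕ n
ones n _ = 1

-- The Ferrers diagram is the first column alone: that column contributes `a`, and each of the other
-- `a` columns contributes 1.
discrepancy-ones : ∀ a → discrepancy (ones (suc a)) (ones (suc a)) ≡ a + a
discrepancy-ones a = cong₂ _+_
  (cong (λ x → ∣ 1 - x ∣) (trans (sym (ferrers-columns (ones (suc a)) (zero {a}))) (sum-one (suc a))))
  (trans (sum-cong-≗ {a} (λ j → cong (λ x → ∣ 1 - x ∣)
      (trans (sym (ferrers-columns (ones (suc a)) (suc j))) (sum-zero (suc a)))))
    (sum-one a))

identity : Matrix n n
identity i j = does (i Fin.≟ j)

identity-lineSums : LineSums (ones n) (ones n) identity
identity-lineSums = lineSums
  (λ i → sum-indicator i (identity i) (dec-true (i Fin.≟ i) refl) (λ j eq → sym (diagonal i j eq)))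
  (λ j → sum-indicator j (λ i → identity i j) (dec-true (j Fin.≟ j) refl) (λ i → diagonal i j))
  where
  diagonal : ∀ (i j : Fin n) → identity i j ≡ true → i ≡ j
  diagonal i j eq with i Fin.≟ j
  ... | yes i≡j = i≡j

ones-not-unique : ∀ a → ¬ UniquelyDetermine (ones (2 + a)) (ones (2 + a))
ones-not-unique a (F , _ , unique-F) = contradiction
  (complete (fromMatrix-represents A′) 0F 0F
    (Equivalence.to (unique-F (fromMatrix-lineSums (same-line-sums identity-lineSums)) (point {2 + a} {2 + a} 0F 0F))
      (Equivalence.from (unique-F (fromMatrix-lineSums (identity-lineSums {2 + a})) (point {2 + a} {2 + a} 0F 0F))
        (Represents.sound (fromMatrix-represents (identity {2 + a})) 0F 0F refl))))
  (λ eq → false≢true A′-i′j eq)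
  -- In this order of rows and columns the identity shows the required pattern, and the second
  -- solution `A′` is empty at `0F`, `0F`, where the identity is full.
  where open Interchange (identity {2 + a}) {1F} {0F} {0F} {1F} refl refl refl refl

-- Here α is `suc a`, and the two sets together have only 2α + 2 elements, counted with
-- multiplicity.
ones-upper-bound : ∀ a F G →
  HasLineSums (ones (2 + a)) (ones (2 + a)) F → HasLineSums (ones (2 + a)) (ones (2 + a)) G →
  card (F △ G) ≤ discrepancy (ones (2 + a)) (ones (2 + a)) + 2
ones-upper-bound a F G sumsF sumsG = begin
  card (F △ G)                                   ≤⟨ card-△ F G ⟩
  card F + card G                                ≡⟨ cong₂ _+_ (card-lineSums sumsF) (card-lineSums sumsG) ⟩
  sum (ones (2 + a)) + sum (ones (2 + a))        ≡⟨ cong (λ k → k + k) (sum-one (2 + a)) ⟩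
  2 + a + (2 + a)                                ≡⟨ solve 1 (λ a → con 2 :+ a :+ (con 2 :+ a) := (con 1 :+ a) :+ (con 1 :+ a) :+ con 2) refl a ⟩
  suc a + suc a + 2                              ≡⟨ cong (_+ 2) (discrepancy-ones (suc a)) ⟨
  discrepancy (ones (2 + a)) (ones (2 + a)) + 2  ∎
  where
  open ≤-Reasoning
  open +-*-Solver

theorem1 : (∀ {m n : ℕ} (R : Vector ℕ m) (C : Vector ℕ n) →
    NonIncreasing R → NonIncreasing C →
    Consistent R C → ¬ UniquelyDetermine R C →
    ∃[ F₂ ] ∃[ F₃ ]
    HasLineSums R C F₂ × HasLineSums R C F₃ ×
    fromℕ 2 ℚ.* α R C ℚ.+ fromℕ 2 ℚ.≤ fromℕ (card (F₂ △ F₃)))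
    ×
    (∀ (a : ℕ) → 1 ≤ a →
    ∃[ m ] ∃[ n ] ∃[ R ] ∃[ C ]
    NonIncreasing {m} R × NonIncreasing {n} C ×
    Consistent R C × ¬ UniquelyDetermine R C ×
    α R C ≡ fromℕ a ×
    (∀ F₂ F₃ → HasLineSums R C F₂ → HasLineSums R C F₃ →
    fromℕ (card (F₂ △ F₃)) ℚ.≤ fromℕ 2 ℚ.* α R C ℚ.+ fromℕ 2))
theorem1 =
  (λ R C _ C-antitone consistent not-unique →
    let F₂ , F₃ , sums₂ , sums₃ , bound = lower-bound R C C-antitone consistent not-unique
    in F₂ , F₃ , sums₂ , sums₃ ,
       subst (ℚ._≤ fromℕ (card (F₂ △ F₃))) (sym (2α+2 R C)) (fromℕ-mono-≤ bound)) ,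
  -- The prescribed value of α is `suc a`, so the length α + 1 of both sequences is `2 + a`.
  λ { (suc a) _ → 2 + a , 2 + a , ones (2 + a) , ones (2 + a) ,
      (λ _ → ≤-refl) , (λ _ → ≤-refl) ,
      (fromMatrix identity , fromMatrix-lineSums identity-lineSums) , ones-not-unique a ,
      trans (cong (λ s → ½ ℚ.* fromℕ s) (discrepancy-ones (suc a))) (half-double (suc a)) ,
      λ F₂ F₃ sums₂ sums₃ →
        subst (fromℕ (card (F₂ △ F₃)) ℚ.≤_) (sym (2α+2 (ones (2 + a)) (ones (2 + a))))
          (fromℕ-mono-≤ (ones-upper-bound a F₂ F₃ sums₂ sums₃)) }
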